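{- Let $a,b\ge 2$ and $n$ be integers with $n-a-b\ge 4$, and let $G=DC(n,a,b)$ be the double comet of order $n$, with nodes $v_1,\ldots,v_a,u_1,\ldots,u_b,w_1,\ldots,w_{n-a-b}$. Put $k=n-a-b$, $r=n-a+2b-1$, $p=n-a+b$. Then, for $v\in V(G)$, $IMC(v)$ equals: - if $v=v_i$ $(1\le i\le a)$: $$\frac{(-k-1)\big(kr-3p(n-a-1)\big)-6\big(b(b-1)-(a-1)(2n-a-2)\big)}{(n-2)\big((k+1)(kr+3ap)+6(b(b-1)+a(a-1))\big)};$$ - if $v=u_j$ $(1\le j\le b)$: $$\frac{(k+1)\big(k(2n+a-2b-2)+3a(a-b+n-2)\big)+6\big((b-1)(-b+2n-2)-a(a-1)\big)}{(n-2)\big((k+1)(kr+3ap)+6(b(b-1)+a(a-1))\big)};$$ - if $v=w_1$: $$\frac{(n-a-2)(k+1)(kr+3ap)+6\big((n-a-2)a(a-1)-(a+1)b(b-1)\big)-(n-1)(k-1)k(r-1)}{(n-a-2)\big((k+1)(kr+3ap)+6(b(b-1)+a(a-1))\big)};$$ - if $v=w_{n-a-b}$: $$\frac{(n-b-2)\big((k+1)(kr+3ap)+6b(b-1)\big)-(n-1)(k-1)k(n+2a-b-2)-(b+1)6a(a-1)}{(n-b-2)\big((k+1)(kr+3ap)+6(b(b-1)+a(a-1))\big)};$$ - if $v=w_t$ $(2\le t\le n-a-b-1)$: $$\frac{(n-3)(k+1)(kr+3ap)-(n-1)(k-1)\big((k-2)(r-2)+3a(p-2)\big)-12\big(b(b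-1)+a(a-1)\big)}{(n-3)\big((k+1)(kr+3ap)+6(b(b-1)+a(a-1))\big)}.$$
   Context: All graphs are finite, simple and undirected. The order of a graph is its number of nodes; $d_{uv}$ denotes the length of a shortest path between nodes $u$ and $v$; a pendent node is a node of degree one. For a connected graph $H$ of order $m\ge 2$, the agglomeration is $$\phi(H)=\frac{m-1}{\sum_{u,v\in V(H),\,u\ne v} d_{uv}},$$ where the sum is over all ordered pairs $(u,v)$ of distinct nodes (equivalently $\phi(H)=1/(mL(H))$, where $L(H)=\frac{1}{m(m-1)}\sum_{u\neq v}d_{uv}$ is the average path length); if $m=1$, then $\phi(H)=1$. For a node $v$ of a graph $G$, the node contraction $G'(v)$ is the simple graph obtained from $G$ by replacing $v$ together with all its $\deg(v)$ neighbors (these $\deg(v)+1$ nodes) by one new node $v'$, which is adjacent to every remaining node that was adjacent in $G$ to at least one of the replaced nodes; adjacency among the remaining nodes is unchanged. The importance of $v$ in $G$ is $$IMC(v)=1-\frac{\phi(G)}{\phi(G'(v))}.$$ For $a,b\ge 1$ and $n\ge a+b+2$, the double comet $DC(n,a,b)$ is the tree on $n$ nodes obtained from a path with $n-a-b$ nodes $w_1,w_2,\ldots,w_{n-a-b}$ (in this order along the path) by attaching $a$ pendent nodes $v_1,\ldots,v_a$ to the end-node $w_1$ and $b$ pendent nodes $u_1,\ldots,u_b$ to the other end-node $w_{n-a-b}$. -}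

module Defs where

open import Data.Empty using (⊥; ⊥-elim)
open import Data.Fin.Base using (Fin; toℕ; fromℕ; fromℕ<)
import Data.Fin.Properties as Fin
open import Data.Integer.Base using (ℤ; +_)
open import Data.List.Base using (List; []; _∷_; _++_; map; filter; length; allFin)
open import Data.List.Membership.Propositional using (_∈_; find; lose)
open import Data.List.Membership.Propositional.Properties using (∈-map⁺; ∈-map⁻; ∈-++⁺ˡ; ∈-++⁺ʳ; ∈-++⁻; ∈-allFin; ∈-filter⁺)
open import Data.List.Relation.Unary.All as All using (All; []; _∷_)
open import Data.List.Relation.Unary.AllPairs using ([]; _∷_)
open import Data.List.Relation.Unary.Any as Any using (here; there; any?)
open import Data.List.Relation.Unary.Unique.Propositional using (Unique)
import Data.List.Relation.Unary.Unique.Propositional.Properties as Unique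
open import Data.Nat.Base as ℕ using (ℕ; zero; suc; _+_; _∸_; _≤_; z≤n; s≤s; NonZero)
open import Data.Nat.ListAction using (sum)
import Data.Nat.Properties as ℕ
open import Data.Product.Base using (Σ-syntax; ∃; ∃-syntax; _×_; _,_; proj₁; proj₂)
open import Data.Rational.Base as ℚ using (ℚ; 1ℚ)
import Data.Rational.Properties as ℚ
open import Data.Sum.Base using (_⊎_; inj₁; inj₂; swap)
open import Relation.Binary.Definitions using (Decidable; DecidableEquality)
open import Relation.Binary.PropositionalEquality using (_≡_; _≢_; refl; sym; trans; cong)
open import Relation.Nullary using (¬_; Dec; yes; no; ¬?; _×-dec_; _⊎-dec_; map′)

record Graph : Set₁ where
  infix 4 _≟_ _∼_ _∼?_
  field
    Node     : Set
    _≟_      : DecidableEquality Node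
    nodes    : List Node
    unique   : Unique nodes
    complete : ∀ x → x ∈ nodes
    _∼_      : Node → Node → Set
    _∼?_     : Decidable _∼_
    ∼-sym    : ∀ {x y} → x ∼ y → y ∼ x
    ∼-irrefl : ∀ {x} → ¬ x ∼ x

  order : ℕ
  order = length nodes

least : (P : ℕ → Set) → (∀ k → Dec (P k)) → ∀ n → P n →
        Σ[ k ∈ ℕ ] P k × (∀ j → P j → k ≤ j)
least P P? zero p = zero , p , λ _ _ → z≤n
least P P? (suc n) p with P? 0
... | yes p₀ = zero , p₀ , λ _ _ → z≤n
... | no ¬p₀ with least (λ k → P (suc k)) (λ k → P? (suc k)) n p
...   | k , pk , k≤ = suc k , pk , λ { zero p₀ → ⊥-elim (¬p₀ p₀) ; (suc j) pj → s≤s (k≤ j pj) }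

module _ (G : Graph) where
  open Graph G

  ∃-node? : {P : Node → Set} → (∀ x → Dec (P x)) → Dec (∃ P)
  ∃-node? P? = map′ (λ p → let x , _ , px = find p in x , px)
                    (λ (x , px) → lose (complete x) px)
                    (any? P? nodes)

  data Walk : ℕ → Node → Node → Set where
    []  : ∀ {x} → Walk 0 x x
    _∷_ : ∀ {k x y z} → x ∼ y → Walk k y z → Walk (suc k) x z

  support : ∀ {k x y} → Walk k x y → List Node
  support {x = x} []      = x ∷ []
  support {x = x} (_ ∷ p) = x ∷ support p

  Path : ℕ → Node → Node → Set
  Path k x y = Σ[ p ∈ Walk k x y ] Unique (support p)

  record Connected : Set where
    field
      inhabited : Node
      path      : ∀ x y → ∃[ k ] Path k x y

  walkWith? : ∀ k x y {P : List Node → Set} → (∀ xs → Dec (P xs)) →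
              Dec (Σ[ p ∈ Walk k x y ] P (support p))
  walkWith? zero x y P? with x ≟ y
  ... | no x≢y = no λ { ([] , _) → x≢y refl }
  ... | yes refl = map′ ([] ,_) (λ { ([] , p) → p }) (P? (x ∷ []))
  walkWith? (suc k) x y P? =
    map′ (λ { (_ , e , p , q) → (e ∷ p) , q })
         (λ { ((e ∷ p) , q) → _ , e , p , q })
         (∃-node? λ z → (x ∼? z) ×-dec walkWith? k z y λ xs → P? (x ∷ xs))

  unique? : ∀ xs → Dec (Unique xs)
  unique? [] = yes []
  unique? (x ∷ xs) = map′ (λ (p , q) → p ∷ q) (λ { (p ∷ q) → p , q })
                          (All.all? (λ y → ¬? (x ≟ y)) xs ×-dec unique? xs)

  path? : ∀ k x y → Dec (Path k x y)
  path? k x y = walkWith? k x y unique?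

  suffix : ∀ {k x y z} (p : Walk k y z) → Unique (support p) → x ∈ support p →
           ∃[ l ] Path l x z
  suffix []      u       (here refl) = 0 , [] , u
  suffix (e ∷ p) u       (here refl) = _ , (e ∷ p) , u
  suffix (e ∷ p) (_ ∷ u) (there x∈)  = suffix p u x∈

  walk⇒path : ∀ {k x y} → Walk k x y → ∃[ l ] Path l x y
  walk⇒path [] = 0 , [] , ([] ∷ [])
  walk⇒path {x = x} (e ∷ p) with walk⇒path p
  ... | l , q , u with any? (x ≟_) (support q)
  ...   | yes x∈ = suffix q u x∈
  ...   | no  x∉ = suc l , (e ∷ q) , (All.tabulate (λ { z∈ refl → x∉ z∈ }) ∷ u)

  joinWalk : ∀ {k l x y z} → Walk k x y → Walk l y z → ∃[ m ] Walk m x z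
  joinWalk []      q = _ , q
  joinWalk (e ∷ p) q = let m , r = joinWalk p q in suc m , e ∷ r

  reverseWalk : ∀ {k x y} → Walk k x y → ∃[ m ] Walk m y x
  reverseWalk []      = 0 , []
  reverseWalk (e ∷ p) = let m , r = reverseWalk p in joinWalk r (∼-sym e ∷ [])

  module _ (c : Connected) where
    open Connected c

    shortest : ∀ x y → Σ[ k ∈ ℕ ] Path k x y × (∀ j → Path j x y → k ≤ j)
    shortest x y =
      let k , p = path x y in least (λ k → Path k x y) (λ k → path? k x y) k p

    dist : Node → Node → ℕ
    dist x y = proj₁ (shortest x y)

    distanceSum : ℕ
    distanceSum =
      sum (map (λ x → sum (map (dist x) (filter (λ y → ¬? (x ≟ y)) nodes))) nodes)

    ∈⇒≤sum : ∀ {A : Set} (f : A → ℕ) {x xs} → x ∈ xs → f x ≤ sum (map f xs)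
    ∈⇒≤sum f {x} (here refl) = ℕ.m≤m+n (f x) _
    ∈⇒≤sum f (there x∈)      = ℕ.≤-trans (∈⇒≤sum f x∈) (ℕ.m≤n+m _ _)

    dist-pos : ∀ {x y} → x ≢ y → 1 ≤ dist x y
    dist-pos {x} {y} x≢y with shortest x y
    ... | zero  , ([] , _) , _ = ⊥-elim (x≢y refl)
    ... | suc k , _            = s≤s z≤n

    twoNodes : order ≢ 1 → Σ[ x ∈ Node ] Σ[ y ∈ Node ] x ≢ y
    twoNodes = go nodes unique (complete inhabited)
      where
      go : (xs : List Node) → Unique xs → inhabited ∈ xs → length xs ≢ 1 → Σ[ x ∈ Node ] Σ[ y ∈ Node ] x ≢ y
      go []           _               ()
      go (x ∷ [])     _               _ m≢1 = ⊥-elim (m≢1 refl)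
      go (x ∷ y ∷ _) ((x≢y ∷ _) ∷ _) _ _   = x , y , x≢y

    distanceSum-nonZero : order ≢ 1 → NonZero distanceSum
    distanceSum-nonZero m≢1 with twoNodes m≢1
    ... | x , y , x≢y = ℕ.>-nonZero (ℕ.≤-trans (dist-pos x≢y) (ℕ.≤-trans
          (∈⇒≤sum (dist x) (∈-filter⁺ (λ z → ¬? (x ≟ z)) (complete y) x≢y))
          (∈⇒≤sum _ (complete x))))

    order∸1-nonZero : order ≢ 1 → NonZero (order ∸ 1)
    order∸1-nonZero = go nodes (complete inhabited)
      where
      go : (xs : List Node) → inhabited ∈ xs → length xs ≢ 1 → NonZero (length xs ∸ 1)
      go []           ()
      go (_ ∷ [])     _ m≢1 = ⊥-elim (m≢1 refl)
      go (_ ∷ _ ∷ _) _ _   = _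

    agglomeration : ℚ
    agglomeration with order ℕ.≟ 1
    ... | yes _  = 1ℚ
    ... | no m≢1 = ((+ (order ∸ 1)) ℚ./ distanceSum) {{distanceSum-nonZero m≢1}}

    agglomeration-nonZero : ℚ.NonZero agglomeration
    agglomeration-nonZero with order ℕ.≟ 1
    ... | yes _  = _
    ... | no m≢1 = ℚ.pos⇒nonZero (((+ (order ∸ 1)) ℚ./ distanceSum) {{distanceSum-nonZero m≢1}})
                     {{ℚ.normalize-pos (order ∸ 1) distanceSum
                       {{distanceSum-nonZero m≢1}} {{order∸1-nonZero m≢1}}}}

  module _ (v : Node) where

    Replaced : Node → Set
    Replaced x = x ≡ v ⊎ v ∼ x

    replaced? : ∀ x → Dec (Replaced x)
    replaced? x = (x ≟ v) ⊎-dec (v ∼? x)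

    data ContractedNode : Set where
      v′   : ContractedNode
      kept : (x : Node) → .(¬ Replaced x) → ContractedNode

    ContractedAdj : ContractedNode → ContractedNode → Set
    ContractedAdj v′         v′         = ⊥
    ContractedAdj v′         (kept x _) = ∃[ y ] Replaced y × y ∼ x
    ContractedAdj (kept x _) v′         = ∃[ y ] Replaced y × y ∼ x
    ContractedAdj (kept x _) (kept y _) = x ∼ y

    keptNodes : List Node → List ContractedNode
    keptNodes []       = []
    keptNodes (x ∷ xs) with replaced? x
    ... | yes _ = keptNodes xs
    ... | no ¬r = kept x ¬r ∷ keptNodes xs

    private
      dec-eq : DecidableEquality ContractedNode
      dec-eq v′         v′         = yes refl
      dec-eq v′         (kept _ _) = no λ ()
      dec-eq (kept _ _) v′         = no λ ()
      dec-eq (kept x _) (kept y _) = map′ (λ { refl → refl }) (λ { refl → refl }) (x ≟ y)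

      adj? : Decidable ContractedAdj
      adj? v′         v′         = no λ ()
      adj? v′         (kept x _) = ∃-node? λ y → replaced? y ×-dec (y ∼? x)
      adj? (kept x _) v′         = ∃-node? λ y → replaced? y ×-dec (y ∼? x)
      adj? (kept x _) (kept y _) = x ∼? y

      adj-sym : ∀ {x y} → ContractedAdj x y → ContractedAdj y x
      adj-sym {v′}       {kept _ _} e = e
      adj-sym {kept _ _} {v′}       e = e
      adj-sym {kept _ _} {kept _ _} e = ∼-sym e

      adj-irrefl : ∀ {x} → ¬ ContractedAdj x x
      adj-irrefl {kept _ _} e = ∼-irrefl e

      kept-∉ : ∀ {x xs} .{r : ¬ Replaced x} → All (x ≢_) xs → All (kept x r ≢_) (keptNodes xs)
      kept-∉ [] = []
      kept-∉ {xs = y ∷ _} (x≢y ∷ x≢) with replaced? y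
      ... | yes _ = kept-∉ x≢
      ... | no  _ = (λ { refl → x≢y refl }) ∷ kept-∉ x≢

      v′-∉ : ∀ xs → All (v′ ≢_) (keptNodes xs)
      v′-∉ [] = []
      v′-∉ (x ∷ xs) with replaced? x
      ... | yes _ = v′-∉ xs
      ... | no  _ = (λ ()) ∷ v′-∉ xs

      kept-unique : ∀ {xs} → Unique xs → Unique (keptNodes xs)
      kept-unique [] = []
      kept-unique {x ∷ _} (x≢ ∷ u) with replaced? x
      ... | yes _ = kept-unique u
      ... | no  _ = kept-∉ x≢ ∷ kept-unique u

      kept-∈ : ∀ {x xs} .(r : ¬ Replaced x) → x ∈ xs → kept x r ∈ keptNodes xs
      kept-∈ {x} r (here refl) with replaced? x
      ... | yes p = ⊥-elim-irr (r p)
        where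
        ⊥-elim-irr : {A : Set} → .⊥ → A
        ⊥-elim-irr ()
      ... | no  _ = here refl
      kept-∈ {xs = y ∷ _} r (there x∈) with replaced? y
      ... | yes _ = kept-∈ r x∈
      ... | no  _ = there (kept-∈ r x∈)

    contraction : Graph
    contraction = record
      { Node     = ContractedNode
      ; _≟_      = dec-eq
      ; nodes    = v′ ∷ keptNodes nodes
      ; unique   = v′-∉ nodes ∷ kept-unique unique
      ; complete = λ { v′ → here refl ; (kept x r) → there (kept-∈ r (complete x)) }
      ; _∼_      = ContractedAdj
      ; _∼?_     = adj?
      ; ∼-sym    = λ {x} {y} → adj-sym {x} {y}
      ; ∼-irrefl = λ {x} → adj-irrefl {x}
      }

module _ (G : Graph) (v : Graph.Node G) where
  open Graph G

  private
    G′ : Graph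
    G′ = contraction G v

    project : Node → ContractedNode G v
    project x with replaced? G v x
    ... | yes _ = v′
    ... | no ¬r = kept x ¬r

    project-edge : ∀ {x y} → x ∼ y → ∃[ m ] Walk G′ m (project x) (project y)
    project-edge {x} {y} e with replaced? G v x | replaced? G v y
    ... | yes _ | yes _ = 0 , []
    ... | yes r | no  _ = 1 , (x , r , e) ∷ []
    ... | no  _ | yes r = 1 , (y , r , ∼-sym e) ∷ []
    ... | no  _ | no  _ = 1 , e ∷ []

    project-walk : ∀ {k x y} → Walk G k x y → ∃[ m ] Walk G′ m (project x) (project y)
    project-walk []      = 0 , []
    project-walk (e ∷ p) = joinWalk G′ (proj₂ (project-edge e)) (proj₂ (project-walk p))

    project-surjective : ∀ x′ → ∃[ x ] project x ≡ x′
    project-surjective v′ = v , eq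
      where
      eq : project v ≡ v′
      eq with replaced? G v v
      ... | yes _ = refl
      ... | no ¬r = ⊥-elim (¬r (inj₁ refl))
    project-surjective (kept x r) = x , eq
      where
      ⊥-elim-irr : {A : Set} → .⊥ → A
      ⊥-elim-irr ()
      eq : project x ≡ kept x r
      eq with replaced? G v x
      ... | yes p = ⊥-elim-irr (r p)
      ... | no  _ = refl

  contraction-connected : Connected G → Connected (contraction G v)
  contraction-connected c = record { inhabited = v′ ; path = path′ }
    where
    path′ : ∀ x′ y′ → ∃[ k ] Path G′ k x′ y′
    path′ x′ y′ with project-surjective x′ | project-surjective y′
    ... | x , refl | y , refl =
      walk⇒path G′ (proj₂ (project-walk (proj₁ (proj₂ (Connected.path c x y)))))

IMC : (G : Graph) → Connected G → Graph.Node G → ℚ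
IMC G c v = 1ℚ ℚ.- (agglomeration G c ℚ.÷ agglomeration (contraction G v) c′)
                      {{agglomeration-nonZero (contraction G v) c′}}
  where
  c′ : Connected (contraction G v)
  c′ = contraction-connected G v c

-- The double comet of order n is meant for a, b ≥ 1 and n ≥ a + b + 2, where the
-- truncated subtraction n ∸ a ∸ b is the true length of the path.
module _ (n a b : ℕ) where

  data CometNode : Set where
    v : Fin a → CometNode
    u : Fin b → CometNode
    w : Fin (n ∸ a ∸ b) → CometNode

  -- Position along the path, counted from 1: the node w_t is w i with position i ≡ t.
  position : Fin (n ∸ a ∸ b) → ℕ
  position i = suc (toℕ i)

  CometAdj : CometNode → CometNode → Set
  CometAdj (v _) (w s) = position s ≡ 1
  CometAdj (w s) (v _) = position s ≡ 1
  CometAdj (u _) (w s) = position s ≡ n ∸ a ∸ b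
  CometAdj (w s) (u _) = position s ≡ n ∸ a ∸ b
  CometAdj (w s) (w t) = position t ≡ suc (position s) ⊎ position s ≡ suc (position t)
  CometAdj (v _) (v _) = ⊥
  CometAdj (v _) (u _) = ⊥
  CometAdj (u _) (v _) = ⊥
  CometAdj (u _) (u _) = ⊥

  v-nodes u-nodes w-nodes cometNodes : List CometNode
  v-nodes = map v (allFin a)
  u-nodes = map u (allFin b)
  w-nodes = map w (allFin (n ∸ a ∸ b))
  cometNodes = v-nodes ++ u-nodes ++ w-nodes

  private
    dec-eq : DecidableEquality CometNode
    dec-eq (v i) (v j) = map′ (cong v) (λ { refl → refl }) (i Fin.≟ j)
    dec-eq (v _) (u _) = no λ ()
    dec-eq (v _) (w _) = no λ ()
    dec-eq (u _) (v _) = no λ ()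
    dec-eq (u i) (u j) = map′ (cong u) (λ { refl → refl }) (i Fin.≟ j)
    dec-eq (u _) (w _) = no λ ()
    dec-eq (w _) (v _) = no λ ()
    dec-eq (w _) (u _) = no λ ()
    dec-eq (w i) (w j) = map′ (cong w) (λ { refl → refl }) (i Fin.≟ j)

    adj? : Decidable CometAdj
    adj? (v _) (v _) = no λ ()
    adj? (v _) (u _) = no λ ()
    adj? (v _) (w s) = position s ℕ.≟ 1
    adj? (u _) (v _) = no λ ()
    adj? (u _) (u _) = no λ ()
    adj? (u _) (w s) = position s ℕ.≟ n ∸ a ∸ b
    adj? (w s) (v _) = position s ℕ.≟ 1
    adj? (w s) (u _) = position s ℕ.≟ n ∸ a ∸ b
    adj? (w s) (w t) = (position t ℕ.≟ suc (position s)) ⊎-dec (position s ℕ.≟ suc (position t))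

    adj-sym : ∀ {x y} → CometAdj x y → CometAdj y x
    adj-sym {v _} {w _} e = e
    adj-sym {u _} {w _} e = e
    adj-sym {w _} {v _} e = e
    adj-sym {w _} {u _} e = e
    adj-sym {w _} {w _} e = swap e

    adj-irrefl : ∀ {x} → ¬ CometAdj x x
    adj-irrefl {w _} (inj₁ e) = ℕ.m≢1+m+n _ (trans e (cong suc (sym (ℕ.+-identityʳ _))))
    adj-irrefl {w _} (inj₂ e) = ℕ.m≢1+m+n _ (trans e (cong suc (sym (ℕ.+-identityʳ _))))

    comet-unique : Unique cometNodes
    comet-unique =
      Unique.++⁺ (Unique.map⁺ (λ { refl → refl }) (Unique.allFin⁺ a))
        (Unique.++⁺ (Unique.map⁺ (λ { refl → refl }) (Unique.allFin⁺ b))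
                    (Unique.map⁺ (λ { refl → refl }) (Unique.allFin⁺ (n ∸ a ∸ b)))
                    u-w)
        v-uw
      where
      u-w : ∀ {x} → ¬ (x ∈ u-nodes × x ∈ w-nodes)
      u-w (p , q) with ∈-map⁻ u p | ∈-map⁻ w q
      ... | _ , _ , refl | _ , _ , ()
      v-uw : ∀ {x} → ¬ (x ∈ v-nodes × x ∈ u-nodes ++ w-nodes)
      v-uw (p , q) with ∈-map⁻ v p | ∈-++⁻ u-nodes q
      ... | _ , _ , refl | inj₁ r with ∈-map⁻ u r
      ...   | _ , _ , ()
      v-uw (p , q) | _ , _ , refl | inj₂ r with ∈-map⁻ w r
      ...   | _ , _ , ()

    comet-complete : ∀ x → x ∈ cometNodes
    comet-complete (v i) = ∈-++⁺ˡ (∈-map⁺ v (∈-allFin i))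
    comet-complete (u i) = ∈-++⁺ʳ v-nodes (∈-++⁺ˡ (∈-map⁺ u (∈-allFin i)))
    comet-complete (w i) = ∈-++⁺ʳ v-nodes (∈-++⁺ʳ u-nodes (∈-map⁺ w (∈-allFin i)))

  DC : Graph
  DC = record
    { Node     = CometNode
    ; _≟_      = dec-eq
    ; nodes    = cometNodes
    ; unique   = comet-unique
    ; complete = comet-complete
    ; _∼_      = CometAdj
    ; _∼?_     = adj?
    ; ∼-sym    = λ {x} {y} → adj-sym {x} {y}
    ; ∼-irrefl = λ {x} → adj-irrefl {x}
    }

  DC-connected : 1 ≤ n ∸ a ∸ b → Connected DC
  DC-connected 1≤k = record { inhabited = w first ; path = path′ }
    where
    first : Fin (n ∸ a ∸ b)
    first = fromℕ< 1≤k

    position-first : position first ≡ 1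
    position-first = cong suc (Fin.toℕ-fromℕ< 1≤k)

    fromW : ∀ m (s : Fin (n ∸ a ∸ b)) → toℕ s ≡ m → ∃[ l ] Walk DC l (w s) (w first)
    fromW zero s eq with Fin.toℕ-injective (trans eq (sym (Fin.toℕ-fromℕ< 1≤k)))
    ... | refl = 0 , []
    fromW (suc m) s eq = let l , p = fromW m t t≡m in suc l , inj₂ e ∷ p
      where
      m<k : m ℕ.< n ∸ a ∸ b
      m<k = ℕ.<-trans (ℕ.≤-reflexive (sym eq)) (Fin.toℕ<n s)
      t : Fin (n ∸ a ∸ b)
      t = fromℕ< m<k
      t≡m : toℕ t ≡ m
      t≡m = Fin.toℕ-fromℕ< m<k
      e : position s ≡ suc (position t)
      e = cong suc (trans eq (cong suc (sym t≡m)))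

    last : Σ[ s ∈ Fin (n ∸ a ∸ b) ] position s ≡ n ∸ a ∸ b
    last = go (n ∸ a ∸ b) 1≤k
      where
      go : ∀ k → 1 ≤ k → Σ[ s ∈ Fin k ] suc (toℕ s) ≡ k
      go (suc k) _ = fromℕ k , cong suc (Fin.toℕ-fromℕ k)

    toFirst : ∀ x → ∃[ l ] Walk DC l x (w first)
    toFirst (v i) = 1 , position-first ∷ []
    toFirst (u j) = let s , e = last ; l , p = fromW _ s refl in suc l , e ∷ p
    toFirst (w s) = fromW _ s refl

    path′ : ∀ x y → ∃[ k ] Path DC k x y
    path′ x y = walk⇒path DC (proj₂ (joinWalk DC (proj₂ (toFirst x))
                                     (proj₂ (reverseWalk DC (proj₂ (toFirst y))))))

-- x is the value of the fraction i / j, whose denominator j is in particular nonzero.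
IsFraction : ℚ → ℤ → ℤ → Set
IsFraction x i j = Σ[ j≢0 ∈ ℚ.NonZero (j ℚ./ 1) ] x ≡ ((i ℚ./ 1) ℚ.÷ (j ℚ./ 1)) {{j≢0}}

{-# OPTIONS --safe #-}

-- Place the path nodes of a double comet at levels 1, …, k and its two sets of leaves at levels 0 and
-- k + 1. Two nodes are adjacent iff their levels differ by 1, and distinct nodes are at distance
-- |difference of levels|, or 2 when the levels agree, so the distance sum depends only on the multiset
-- of levels. Every node contraction is again a double comet: contracting a leaf deletes it, and
-- contracting w_t merges three consecutive levels, where for t = 1 or t = k the leaves of that end
-- become a single leaf. With Δ three times the distance sum, N the order of G and m that of the
-- contraction G′, the importance is ((m − 1) Δ(G) − (N − 1) Δ(G′)) / ((m − 1) Δ(G)), and the stated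
-- formulas are polynomial identities.
module Submission where

open import Defs
open import Data.Empty using (⊥-elim; ⊥-elim-irr)
open import Data.Fin.Base using (Fin; toℕ)
import Data.Fin.Properties as Fin
open import Data.List.Base using (List; []; _∷_; _++_; map; filter; length; replicate; allFin; tabulate)
open import Data.List.Membership.Propositional using (_∈_)
open import Data.List.Membership.Propositional.Properties using (∈-map⁺; ∈-map⁻; ∈-++⁺ʳ)
open import Data.List.Properties using (filter-all; filter-none; filter-++; filter-accept; filter-reject; map-++; map-id; map-∘; map-cong; map-cong-local; map-replicate; map-tabulate; length-map; length-++; length-replicate; length-tabulate)
open import Data.List.Relation.Binary.Permutation.Propositional using (_↭_; prep; swap; ↭-refl; ↭-reflexive; ↭-sym; ↭-trans; module PermutationReasoning)
open import Data.List.Relation.Binary.Permutation.Propositional.Properties using (∈-resp-↭; ↭-length; map⁺; shift; shifts; drop-∷; ++⁺ˡ; filter-↭)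
open import Data.List.Relation.Unary.All as All using (All; []; _∷_)
import Data.List.Relation.Unary.All.Properties as All
open import Data.List.Relation.Unary.AllPairs using ([]; _∷_)
open import Data.List.Relation.Unary.Any using (here; there; any?)
open import Data.List.Relation.Unary.Unique.Propositional using (Unique)
import Data.List.Relation.Unary.Unique.Propositional.Properties as Unique
open import Data.Nat.Base as ℕ using (ℕ; zero; suc; _∸_; _≤_; _<_; z≤n; s≤s; ∣_-_∣; NonZero)
open import Data.Nat.ListAction using (sum)
open import Data.Nat.ListAction.Properties using (sum-++; sum-↭)
import Data.Nat.Properties as ℕ
open import Data.Nat.Properties using (≤-trans)
open import Data.Product.Base using (∃-syntax; _×_; _,_; proj₁; proj₂)
open import Data.Rational.Base as ℚ using (ℚ; 1ℚ)
import Data.Rational.Properties as ℚ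
open import Data.Rational.Unnormalised.Base as ℚᵘ using (mkℚᵘ; *≡*)
import Data.Rational.Unnormalised.Properties as ℚᵘ
open import Data.Sum.Base using (_⊎_; inj₁; inj₂; [_,_]′)
open import Function.Base using (_∘_; const)
open import Relation.Binary.Definitions using (DecidableEquality)
open import Relation.Binary.PropositionalEquality using (_≡_; _≢_; refl; sym; trans; cong; cong₂; subst; subst₂; module ≡-Reasoning)
open import Relation.Nullary using (¬_; yes; no; ¬?)

module _ where

  open import Data.Nat.Base using (_+_; _*_)
  open import Data.Nat.Tactic.RingSolver using (solve-∀)

  -- Removing an entry from a list.

  module _ {A : Set} (_≟_ : DecidableEquality A) where

    _without_ : List A → A → List A
    xs without x = filter (λ y → ¬? (x ≟ y)) xs

    without-∉ : ∀ {x xs} → All (x ≢_) xs → xs without x ≡ xs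
    without-∉ {x} = filter-all (λ y → ¬? (x ≟ y))

    without-≡ : ∀ x xs → (x ∷ xs) without x ≡ xs without x
    without-≡ x xs = filter-reject (λ y → ¬? (x ≟ y)) {xs = xs} (λ x≢x → x≢x refl)

    -- Filtering discards every occurrence of `x`; uniqueness makes that a single one, so one `x`
    -- restores the list.
    without-↭ : ∀ {x xs} → Unique xs → x ∈ xs → x ∷ (xs without x) ↭ xs
    without-↭ {x} {_ ∷ xs} (x≢ ∷ _) (here refl) =
      prep x (↭-reflexive (trans (without-≡ x xs) (without-∉ x≢)))
    without-↭ {x} {y ∷ ys} (y≢ ∷ ys!) (there x∈) =
      ↭-trans (prep x (↭-reflexive (filter-accept (λ y → ¬? (x ≟ y)) {xs = ys}
                                          (λ x≡y → All.lookup y≢ x∈ (sym x≡y)))))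
              (↭-trans (swap x y ↭-refl) (prep y (without-↭ ys! x∈)))

  -- Level lists of double comets.

  range : ℕ → List ℕ
  range zero    = []
  range (suc k) = 1 ∷ map suc (range k)

  -- The blocks stand in the order of `cometNodes`, so that `DC-levels` is an equality and not
  -- merely a permutation.
  cometLevels : ℕ → ℕ → ℕ → List ℕ
  cometLevels a b k = replicate a 0 ++ replicate b (suc k) ++ range k

  ∈-range⁺ : ∀ {m k} → m < k → suc m ∈ range k
  ∈-range⁺ {zero}  (s≤s _)   = here refl
  ∈-range⁺ {suc m} (s≤s m<k) = there (∈-map⁺ suc (∈-range⁺ m<k))

  range-bounds : ∀ k → All (λ m → 1 ≤ m × m ≤ k) (range k)
  range-bounds zero    = []
  range-bounds (suc k) =
    (s≤s z≤n , s≤s z≤n) ∷ All.map⁺ (All.map (λ (_ , m≤k) → s≤s z≤n , s≤s m≤k) (range-bounds k))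

  range-unique : ∀ k → Unique (range k)
  range-unique zero    = []
  range-unique (suc k) =
    All.map⁺ (All.map (λ { (() , _) refl }) (range-bounds k)) ∷ Unique.map⁺ ℕ.suc-injective (range-unique k)

  length-range : ∀ k → length (range k) ≡ k
  length-range zero    = refl
  length-range (suc k) = cong suc (trans (length-map suc (range k)) (length-range k))

  length-cometLevels : ∀ a b k → length (cometLevels a b k) ≡ a + (b + k)
  length-cometLevels a b k =
    trans (length-++ (replicate a 0))
      (cong₂ _+_ (length-replicate a)
        (trans (length-++ (replicate b (suc k))) (cong₂ _+_ (length-replicate b) (length-range k))))

  -- Distance sums over level lists.

  -- The distance of distinct nodes whose levels differ by d.
  sep : ℕ → ℕ
  sep zero    = 2
  sep (suc d) = suc d

  Σsep : ℕ → List ℕ → ℕ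
  Σsep p ys = sum (map (λ q → sep ∣ p - q ∣) ys)

  -- When both arguments list the levels of one graph, each node is also paired with itself and
  -- contributes `sep 0`, that is 2. The term `2 * order` in `distanceSum-comet` accounts for this
  -- surplus.
  ΣΣsep : List ℕ → List ℕ → ℕ
  ΣΣsep xs ys = sum (map (λ p → Σsep p ys) xs)

  Σsep-++ : ∀ p xs ys → Σsep p (xs ++ ys) ≡ Σsep p xs + Σsep p ys
  Σsep-++ p xs ys = trans (cong sum (map-++ _ xs ys)) (sum-++ (map _ xs) _)

  ΣΣsep-++ˡ : ∀ xs ys zs → ΣΣsep (xs ++ ys) zs ≡ ΣΣsep xs zs + ΣΣsep ys zs
  ΣΣsep-++ˡ xs ys zs = trans (cong sum (map-++ _ xs ys)) (sum-++ (map _ xs) _)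

  sum-map-+ : ∀ {A : Set} (f g : A → ℕ) xs →
              sum (map (λ x → f x + g x) xs) ≡ sum (map f xs) + sum (map g xs)
  sum-map-+ f g []       = refl
  sum-map-+ f g (x ∷ xs) rewrite sum-map-+ f g xs = interchange (f x) (g x) _ _
    where
    interchange : ∀ a b c d → a + b + (c + d) ≡ a + c + (b + d)
    interchange = solve-∀

  sum-map-const : ∀ {A : Set} c (xs : List A) → sum (map (const c) xs) ≡ length xs * c
  sum-map-const c []       = refl
  sum-map-const c (x ∷ xs) = cong (c +_) (sum-map-const c xs)

  ΣΣsep-∷ʳ : ∀ xs y ys → ΣΣsep xs (y ∷ ys) ≡ Σsep y xs + ΣΣsep xs ys
  ΣΣsep-∷ʳ xs y ys = trans (sum-map-+ (λ p → sep ∣ p - y ∣) (λ p → Σsep p ys) xs)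
    (cong (λ l → sum l + ΣΣsep xs ys) (map-cong (λ p → cong sep (ℕ.∣-∣-comm p y)) xs))

  ΣΣsep-[]ʳ : ∀ xs → ΣΣsep xs [] ≡ 0
  ΣΣsep-[]ʳ xs = trans (sum-map-const 0 xs) (ℕ.*-zeroʳ (length xs))

  ΣΣsep-comm : ∀ xs ys → ΣΣsep xs ys ≡ ΣΣsep ys xs
  ΣΣsep-comm xs []       = ΣΣsep-[]ʳ xs
  ΣΣsep-comm xs (y ∷ ys) = trans (ΣΣsep-∷ʳ xs y ys) (cong (Σsep y xs +_) (ΣΣsep-comm xs ys))

  Σsep-replicate : ∀ p n q → Σsep p (replicate n q) ≡ n * sep ∣ p - q ∣
  Σsep-replicate p zero    q = refl
  Σsep-replicate p (suc n) q = cong (sep ∣ p - q ∣ +_) (Σsep-replicate p n q)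

  ΣΣsep-replicate : ∀ n p ys → ΣΣsep (replicate n p) ys ≡ n * Σsep p ys
  ΣΣsep-replicate zero    p ys = refl
  ΣΣsep-replicate (suc n) p ys = cong (Σsep p ys +_) (ΣΣsep-replicate n p ys)

  Σsep-map-suc : ∀ p xs → Σsep (suc p) (map suc xs) ≡ Σsep p xs
  Σsep-map-suc p xs = cong sum (sym (map-∘ xs))

  ΣΣsep-map-suc : ∀ xs ys → ΣΣsep (map suc xs) (map suc ys) ≡ ΣΣsep xs ys
  ΣΣsep-map-suc xs ys =
    cong sum (trans (sym (map-∘ xs)) (map-cong (λ p → Σsep-map-suc p ys) xs))

  triangle : ℕ → ℕ
  triangle zero    = 0
  triangle (suc k) = suc k + triangle k

  2*triangle : ∀ k → 2 * triangle k ≡ k * suc k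
  2*triangle zero    = refl
  2*triangle (suc k) = trans (ℕ.*-distribˡ-+ 2 (suc k) (triangle k))
    (trans (cong (2 * suc k +_) (2*triangle k)) (arith k))
    where
    arith : ∀ k → 2 * suc k + k * suc k ≡ suc k * suc (suc k)
    arith = solve-∀

  -- Each summand grows by 1. Positivity matters because `sep 0` is 2: raising a level from 0 to 1
  -- would lower its summand.
  Σsep-0-map-suc : ∀ {xs} → All (1 ≤_) xs → Σsep 0 (map suc xs) ≡ length xs + Σsep 0 xs
  Σsep-0-map-suc []               = refl
  Σsep-0-map-suc {suc x ∷ xs} (s≤s _ ∷ 1≤) rewrite Σsep-0-map-suc 1≤ = arith x (length xs) (Σsep 0 xs)
    where
    arith : ∀ x l s → suc (suc x) + (l + s) ≡ suc l + (suc x + s)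
    arith = solve-∀

  Σsep-range-below : ∀ k → Σsep 0 (range k) ≡ triangle k
  Σsep-range-below zero    = refl
  Σsep-range-below (suc k) =
    cong suc (trans (Σsep-0-map-suc (All.map proj₁ (range-bounds k)))
                    (cong₂ _+_ (length-range k) (Σsep-range-below k)))

  Σsep-range-above : ∀ k → Σsep (suc k) (range k) ≡ triangle k
  Σsep-range-above zero    = refl
  Σsep-range-above (suc k) =
    cong (suc k +_) (trans (Σsep-map-suc (suc k) (range k)) (Σsep-range-above k))

  -- Pairs of distinct levels give the classical (k^3 - k)/3 of a path on `k` nodes, the diagonal
  -- adds 2k, and the factor 3 clears the denominator. The induction splits level 1 off both copies
  -- and uses that `sep` of a difference is invariant under translation.
  3*ΣΣsep-range : ∀ k → 3 * ΣΣsep (range k) (range k) ≡ k * k * k + 5 * k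
  3*ΣΣsep-range zero    = refl
  3*ΣΣsep-range (suc k) = begin
    3 * (2 + Σsep 1 ys + ΣΣsep ys (1 ∷ ys))
      ≡⟨ cong (λ s → 3 * (2 + Σsep 1 ys + s)) (ΣΣsep-∷ʳ ys 1 ys) ⟩
    3 * (2 + Σsep 1 ys + (Σsep 1 ys + ΣΣsep ys ys))
      ≡⟨ cong₂ (λ s t → 3 * (2 + s + (s + t)))
               (trans (Σsep-map-suc 0 (range k)) (Σsep-range-below k))
               (ΣΣsep-map-suc (range k) (range k)) ⟩
    3 * (2 + triangle k + (triangle k + ΣΣsep (range k) (range k)))
      ≡⟨ regroup (triangle k) _ ⟩
    6 + 3 * (2 * triangle k) + 3 * ΣΣsep (range k) (range k)
      ≡⟨ cong₂ (λ s t → 6 + 3 * s + t) (2*triangle k) (3*ΣΣsep-range k) ⟩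
    6 + 3 * (k * suc k) + (k * k * k + 5 * k)
      ≡⟨ arith k ⟩
    suc k * suc k * suc k + 5 * suc k ∎
    where
    open ≡-Reasoning
    ys = map suc (range k)
    regroup : ∀ t r → 3 * (2 + t + (t + r)) ≡ 6 + 3 * (2 * t) + 3 * r
    regroup = solve-∀
    arith : ∀ k → 6 + 3 * (k * suc k) + (k * k * k + 5 * k) ≡ suc k * suc k * suc k + 5 * suc k
    arith = solve-∀

  -- Both copies are cut into lower leaves, upper leaves and path. Blocks of leaves against leaves
  -- are constant, blocks of leaves against the path are multiples of `triangle k`, and the path
  -- against itself is `3*ΣΣsep-range`.
  3*ΣΣsep-cometLevels : ∀ a b k → let ls = cometLevels a b k in
    3 * ΣΣsep ls ls ≡
    6 * a * a + 6 * a * b * suc k + 3 * (a + b) * (k * suc k) + 6 * b * b + (k * k * k + 5 * k)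
  3*ΣΣsep-cometLevels a b k = begin
    3 * ΣΣsep ls ls
      ≡⟨ cong (3 *_) (trans (ΣΣsep-++ˡ as (bs ++ ws) ls)
           (cong (ΣΣsep as ls +_) (ΣΣsep-++ˡ bs ws ls))) ⟩
    3 * (ΣΣsep as ls + (ΣΣsep bs ls + ΣΣsep ws ls))
      ≡⟨ cong (3 *_) (cong₂ _+_ (row a 0) (cong₂ _+_ (row b (suc k))
           (trans (ΣΣsep-comm ws ls)
             (trans (ΣΣsep-++ˡ as (bs ++ ws) ws)
               (cong₂ _+_ (ΣΣsep-replicate a 0 ws)
                 (trans (ΣΣsep-++ˡ bs ws ws) (cong (_+ ΣΣsep ws ws) (ΣΣsep-replicate b (suc k) ws)))))))) ⟩
    3 * (a * (a * 2 + (b * suc k + Σsep 0 ws)) +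
        (b * (a * suc k + (b * sep ∣ k - k ∣ + Σsep (suc k) ws)) +
        (a * Σsep 0 ws + (b * Σsep (suc k) ws + ΣΣsep ws ws))))
      -- The upper leaves against each other: `∣ k - k ∣` has to be rewritten to 0 before `sep`
      -- yields 2.
      ≡⟨ cong (λ z → 3 * (a * (a * 2 + (b * suc k + Σsep 0 ws)) +
        (b * (a * suc k + (b * sep z + Σsep (suc k) ws)) +
        (a * Σsep 0 ws + (b * Σsep (suc k) ws + ΣΣsep ws ws))))) (ℕ.∣n-n∣≡0 k) ⟩
    3 * (a * (a * 2 + (b * suc k + Σsep 0 ws)) +
        (b * (a * suc k + (b * 2 + Σsep (suc k) ws)) +
        (a * Σsep 0 ws + (b * Σsep (suc k) ws + ΣΣsep ws ws))))
      ≡⟨ cong₂ (λ s t → 3 * (a * (a * 2 + (b * suc k + s)) +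
        (b * (a * suc k + (b * 2 + t)) +
        (a * s + (b * t + ΣΣsep ws ws))))) (Σsep-range-below k) (Σsep-range-above k) ⟩
    3 * (a * (a * 2 + (b * suc k + triangle k)) +
        (b * (a * suc k + (b * 2 + triangle k)) +
        (a * triangle k + (b * triangle k + ΣΣsep ws ws))))
      ≡⟨ regroup a b k (triangle k) (ΣΣsep ws ws) ⟩
    6 * a * a + 6 * a * b * suc k + 3 * (a + b) * (2 * triangle k) + 6 * b * b + 3 * ΣΣsep ws ws
      ≡⟨ cong₂ (λ s t → 6 * a * a + 6 * a * b * suc k + 3 * (a + b) * s + 6 * b * b + t)
               (2*triangle k) (3*ΣΣsep-range k) ⟩
    6 * a * a + 6 * a * b * suc k + 3 * (a + b) * (k * suc k) + 6 * b * b + (k * k * k + 5 * k) ∎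
    where
    open ≡-Reasoning
    as = replicate a 0
    bs = replicate b (suc k)
    ws = range k
    ls = cometLevels a b k
    row : ∀ n p → ΣΣsep (replicate n p) ls ≡
          n * (a * sep ∣ p - 0 ∣ + (b * sep ∣ p - suc k ∣ + Σsep p ws))
    row n p = trans (ΣΣsep-replicate n p ls) (cong (n *_)
      (trans (Σsep-++ p as (bs ++ ws)) (cong₂ _+_ (Σsep-replicate p a 0)
        (trans (Σsep-++ p bs ws) (cong (_+ Σsep p ws) (Σsep-replicate p b (suc k)))))))
    regroup : ∀ a b k t r →
      3 * (a * (a * 2 + (b * suc k + t)) + (b * (a * suc k + (b * 2 + t)) + (a * t + (b * t + r)))) ≡
      6 * a * a + 6 * a * b * suc k + 3 * (a + b) * (2 * t) + 6 * b * b + 3 * r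
    regroup = solve-∀

  -- Double comets described by levels.

  -- The double comet up to relabelling, for arbitrary a, b, k: k path nodes at levels 1, …, k,
  -- a leaves at level 0 and b leaves at level k + 1. Adjacency is then exactly a level difference of 1.
  record IsComet (G : Graph) (a b k : ℕ) : Set where
    open Graph G
    field
      level  : Node → ℕ
      ∼⇒gap  : ∀ {x y} → x ∼ y → ∣ level x - level y ∣ ≡ 1
      gap⇒∼  : ∀ {x y} → ∣ level x - level y ∣ ≡ 1 → x ∼ y
      levels : map level nodes ↭ cometLevels a b k

  ∣1+n-n∣≡1 : ∀ n → ∣ suc n - n ∣ ≡ 1
  ∣1+n-n∣≡1 zero    = refl
  ∣1+n-n∣≡1 (suc n) = ∣1+n-n∣≡1 n

  -- The first step of a level-monotone walk from `p` to `q`. The last component bounds `m` by an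
  -- endpoint, which lets `inhabited` provide a node at that level.
  between : ∀ p q {d} → ∣ p - q ∣ ≡ suc (suc d) →
            ∃[ m ] ∣ p - m ∣ ≡ 1 × ∣ m - q ∣ ≡ suc d × (m ≤ p ⊎ m ≤ q)
  between zero          (suc (suc q)) refl = 1 , refl , refl , inj₂ (s≤s z≤n)
  between (suc (suc p)) zero          refl = suc p , ∣1+n-n∣≡1 p , refl , inj₁ (ℕ.n≤1+n _)
  between (suc p) (suc q) e with between p q e
  ... | m , e₁ , e₂ , m≤ = suc m , e₁ , e₂ , [ inj₁ ∘ s≤s , inj₂ ∘ s≤s ]′ m≤

  -- Supplies the middle of a walk of length 2 between two nodes of equal level: the level below, or
  -- level 1 when `p` is 0.
  neighbourLevel : ∀ p {k} → p ≤ suc k → ∃[ m ] ∣ p - m ∣ ≡ 1 × ∣ m - p ∣ ≡ 1 × m ≤ suc k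
  neighbourLevel zero    _         = 1 , refl , refl , s≤s z≤n
  neighbourLevel (suc zero) _      = 0 , refl , refl , z≤n
  neighbourLevel (suc (suc p)) {suc k} (s≤s p≤) with neighbourLevel (suc p) p≤
  ... | m , e₁ , e₂ , m≤ = suc m , e₁ , e₂ , s≤s m≤

  -- Distances bounded by walks.

  module _ (G : Graph) where
    open Graph G

    suffix-≤ : ∀ {k x y z} (q : Walk G k y z) (q! : Unique (support G q)) (x∈ : x ∈ support G q) →
               proj₁ (suffix G q q! x∈) ≤ k
    suffix-≤ []      _        (here refl) = z≤n
    suffix-≤ (_ ∷ _) _        (here refl) = ℕ.≤-refl
    suffix-≤ (_ ∷ q) (_ ∷ q!) (there x∈)  = ℕ.m≤n⇒m≤1+n (suffix-≤ q q! x∈)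

    -- `dist` minimises over paths only. Cutting out loops never lengthens a walk, so any walk
    -- bounds the distance from above.
    walk⇒path-≤ : ∀ {k x y} (q : Walk G k x y) → proj₁ (walk⇒path G q) ≤ k
    walk⇒path-≤ [] = z≤n
    walk⇒path-≤ {x = x} (_ ∷ q) with walk⇒path G q | walk⇒path-≤ q
    ... | l , q′ , q′! | l≤ with any? (x ≟_) (support G q′)
    ...   | yes x∈ = ℕ.m≤n⇒m≤1+n (≤-trans (suffix-≤ q′ q′! x∈) l≤)
    ...   | no  _  = s≤s l≤

    module _ (c : Connected G) where

      dist-≤ : ∀ {k x y} → Walk G k x y → dist G c x y ≤ k
      dist-≤ q = ≤-trans (proj₂ (proj₂ (shortest G c _ _)) _ (proj₂ (walk⇒path G q))) (walk⇒path-≤ q)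

      shortestWalk : ∀ x y → Walk G (dist G c x y) x y
      shortestWalk x y = proj₁ (proj₁ (proj₂ (shortest G c x y)))

  -- Distances in a double comet.

  module _ {G : Graph} {a b k : ℕ} (C : IsComet G (suc a) (suc b) k) where
    open Graph G
    open IsComet C

    -- The leaf counts `suc a` and `suc b` are positive, so the two leaf levels are occupied as well
    -- as the path levels.
    inhabited : ∀ {m} → m ≤ suc k → ∃[ x ] level x ≡ m
    inhabited {m} m≤ with ∈-map⁻ level (∈-resp-↭ (↭-sym levels) (m∈ m m≤))
      where
      m∈ : ∀ m → m ≤ suc k → m ∈ cometLevels (suc a) (suc b) k
      m∈ zero    _         = here refl
      m∈ (suc m) (s≤s m≤k) with ℕ.m≤n⇒m<n∨m≡n m≤k
      ... | inj₁ m<k  = ∈-++⁺ʳ (replicate (suc a) 0) (∈-++⁺ʳ (replicate (suc b) (suc k)) (∈-range⁺ m<k))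
      ... | inj₂ refl = ∈-++⁺ʳ (replicate (suc a) 0) (here refl)
    ... | x , _ , m≡ = x , sym m≡

    level-≤ : ∀ x → level x ≤ suc k
    level-≤ x = All.lookup bounds (∈-resp-↭ levels (∈-map⁺ level (complete x)))
      where
      bounds : All (_≤ suc k) (cometLevels (suc a) (suc b) k)
      bounds = All.++⁺ (All.replicate⁺ (suc a) z≤n) (All.++⁺ (All.replicate⁺ (suc b) ℕ.≤-refl)
                 (All.map (ℕ.m≤n⇒m≤1+n ∘ proj₂) (range-bounds k)))

    order-comet : order ≡ suc a + (suc b + k)
    order-comet = trans (sym (length-map level nodes))
      (trans (↭-length levels) (length-cometLevels (suc a) (suc b) k))

    monotoneWalk : ∀ d {x y} → ∣ level x - level y ∣ ≡ suc d → Walk G (suc d) x y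
    monotoneWalk zero    e = gap⇒∼ e ∷ []
    monotoneWalk (suc d) {x} {y} e with between (level x) (level y) e
    ... | m , e₁ , e₂ , m≤ with inhabited ([ (λ m≤x → ≤-trans m≤x (level-≤ x))
                                              , (λ m≤y → ≤-trans m≤y (level-≤ y)) ]′ m≤)
    ...   | z , refl = gap⇒∼ e₁ ∷ monotoneWalk d e₂

    gap≤length : ∀ {l x y} → Walk G l x y → ∣ level x - level y ∣ ≤ l
    gap≤length {x = x} [] = ℕ.≤-reflexive (ℕ.∣n-n∣≡0 (level x))
    gap≤length {x = x} {y} (_∷_ {y = z} e q) =
      ≤-trans (ℕ.∣-∣-triangle (level x) (level z) (level y))
                (ℕ.+-mono-≤ (ℕ.≤-reflexive (∼⇒gap e)) (gap≤length q))

    module _ (c : Connected G) where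

      -- For different levels, every edge changes the level by 1, so the gap is a lower bound, and
      -- `monotoneWalk` attains it. For equal levels an edge would force a gap of 1, while a detour
      -- through a neighbouring level has length 2.
      dist-comet : ∀ {x y} → x ≢ y → dist G c x y ≡ sep ∣ level x - level y ∣
      dist-comet {x} {y} x≢y with ∣ level x - level y ∣ in e
      ... | suc d = ℕ.≤-antisym (dist-≤ G c (monotoneWalk d e))
                                (subst (_≤ dist G c x y) e (gap≤length (shortestWalk G c x y)))
      ... | zero  = ℕ.≤-antisym (dist-≤ G c detour) (2≤length (shortestWalk G c x y))
        where
        detour : Walk G 2 x y
        detour with neighbourLevel (level x) (level-≤ x)
        ... | m , e₁ , e₂ , m≤ with inhabited m≤
        ...   | z , refl = gap⇒∼ e₁ ∷ gap⇒∼ (subst (λ p → ∣ level z - p ∣ ≡ 1) (ℕ.∣m-n∣≡0⇒m≡n e) e₂) ∷ []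
        2≤length : ∀ {l} → Walk G l x y → 2 ≤ l
        2≤length []          = ⊥-elim (x≢y refl)
        2≤length (f ∷ [])    with trans (sym e) (∼⇒gap f)
        ... | ()
        2≤length (_ ∷ _ ∷ _) = s≤s (s≤s z≤n)

      -- The 2 added for each node is the entry `sep 0` of the node with itself. It completes each
      -- row to a sum over all nodes, and such sums depend only on the multiset of levels.
      distanceSum-comet : let ls = cometLevels (suc a) (suc b) k in
                          distanceSum G c + 2 * order ≡ ΣΣsep ls ls
      distanceSum-comet = begin
        distanceSum G c + 2 * order
          ≡⟨ trans (ℕ.+-comm _ (2 * order)) (cong (_+ distanceSum G c)
               (trans (ℕ.*-comm 2 order) (sym (sum-map-const 2 nodes)))) ⟩
        sum (map (const 2) nodes) + sum (map row nodes)
          ≡⟨ sum-map-+ (const 2) row nodes ⟨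
        sum (map (λ x → 2 + row x) nodes)
          ≡⟨ cong sum (map-cong row-levels nodes) ⟩
        sum (map (λ x → Σsep (level x) ls) nodes)
          ≡⟨ cong sum (map-∘ nodes) ⟩
        ΣΣsep (map level nodes) ls
          ≡⟨ sum-↭ (map⁺ (λ p → Σsep p ls) levels) ⟩
        ΣΣsep ls ls ∎
        where
        open ≡-Reasoning
        ls = cometLevels (suc a) (suc b) k
        row : Node → ℕ
        row x = sum (map (dist G c x) (_without_ _≟_ nodes x))
        row-levels : ∀ x → 2 + row x ≡ Σsep (level x) ls
        row-levels x = begin
          2 + row x
            ≡⟨ cong₂ (λ d l → sep d + sum l) (sym (ℕ.∣n-n∣≡0 (level x)))
                 (map-cong-local (All.map dist-comet (All.all-filter (λ y → ¬? (x ≟ y)) nodes))) ⟩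
          sum (map (λ y → sep ∣ level x - level y ∣) (x ∷ _without_ _≟_ nodes x))
            ≡⟨ sum-↭ (map⁺ _ (without-↭ _≟_ unique (complete x))) ⟩
          sum (map (λ y → sep ∣ level x - level y ∣) nodes)
            ≡⟨ cong sum (map-∘ nodes) ⟩
          Σsep (level x) (map level nodes)
            ≡⟨ sum-↭ (map⁺ _ levels) ⟩
          Σsep (level x) ls ∎

  -- Level lists with one level emptied and refilled by a single entry.

  infixl 6 _∖_
  _∖_ : List ℕ → ℕ → List ℕ
  _∖_ = _without_ ℕ._≟_

  cometLevels-∖ : ∀ a b k {m} → cometLevels a b k ∖ m ≡
                  (replicate a 0 ∖ m) ++ (replicate b (suc k) ∖ m) ++ (range k ∖ m)
  cometLevels-∖ a b k {m} = trans (filter-++ m≢? (replicate a 0) _)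
    (cong ((replicate a 0 ∖ m) ++_) (filter-++ m≢? (replicate b (suc k)) (range k)))
    where m≢? = λ y → ¬? (m ℕ.≟ y)

  replicate-∖ : ∀ n {m p} → m ≢ p → replicate n p ∖ m ≡ replicate n p
  replicate-∖ n m≢p = without-∉ ℕ._≟_ (All.replicate⁺ n m≢p)

  replicate-∖-≡ : ∀ n m → replicate n m ∖ m ≡ []
  replicate-∖-≡ n m = filter-none (λ y → ¬? (m ℕ.≟ y)) (All.replicate⁺ n (λ m≢m → m≢m refl))

  range-∖ : ∀ {k m} → ¬ (1 ≤ m × m ≤ k) → range k ∖ m ≡ range k
  range-∖ {k} ¬m = without-∉ ℕ._≟_ (All.map (λ { q refl → ¬m q }) (range-bounds k))

  -- An inner level carries exactly one path node, so emptying it and adding one entry changes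
  -- nothing.
  refill-inner : ∀ a b {k m} → 1 ≤ m → m ≤ k → m ∷ (cometLevels a b k ∖ m) ↭ cometLevels a b k
  refill-inner a b {k} {suc m} 1≤m m≤k = begin
    suc m ∷ (cometLevels a b k ∖ suc m)
      ≡⟨ cong (suc m ∷_) (trans (cometLevels-∖ a b k)
           (cong₂ (λ l l′ → l ++ l′ ++ (range k ∖ suc m)) (replicate-∖ a λ ())
             (replicate-∖ b (ℕ.<⇒≢ (s≤s m≤k))))) ⟩
    suc m ∷ as ++ bs ++ (range k ∖ suc m)
      ↭⟨ shift (suc m) as _ ⟨
    as ++ suc m ∷ bs ++ (range k ∖ suc m)
      ↭⟨ ++⁺ˡ as (shift (suc m) bs _) ⟨
    as ++ bs ++ suc m ∷ (range k ∖ suc m)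
      ↭⟨ ++⁺ˡ as (++⁺ˡ bs (without-↭ ℕ._≟_ (range-unique k) (∈-range⁺ m≤k))) ⟩
    as ++ bs ++ range k ∎
    where
    open PermutationReasoning
    as = replicate a 0
    bs = replicate b (suc k)

  -- Level 0 holds only leaves, so all `a` of them disappear and the new entry is the one leaf left;
  -- `refill-top` is the mirror image.
  refill-bottom : ∀ a b k → 0 ∷ (cometLevels a b k ∖ 0) ↭ cometLevels 1 b k
  refill-bottom a b k = ↭-reflexive (cong (0 ∷_) (trans (cometLevels-∖ a b k)
    (cong₂ _++_ (replicate-∖-≡ a 0) (cong₂ _++_ (replicate-∖ b λ ()) (range-∖ {k} λ { (() , _) })))))

  refill-top : ∀ a b k → suc k ∷ (cometLevels a b k ∖ suc k) ↭ cometLevels a 1 k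
  refill-top a b k = ↭-trans (↭-reflexive (cong (suc k ∷_) (trans (cometLevels-∖ a b k)
    (cong₂ _++_ (replicate-∖ a λ ()) (cong₂ _++_ (replicate-∖-≡ b (suc k))
      (range-∖ {k} λ (_ , k<k) → ℕ.<-irrefl refl k<k))))))
    (↭-sym (shift (suc k) (replicate a 0) (range k)))

  -- Merging three consecutive levels.

  -- The relabelling of levels when s, s + 1 and s + 2 are merged into s.
  squash : ℕ → ℕ → ℕ
  squash zero    p       = p ∸ 2
  squash (suc s) zero    = zero
  squash (suc s) (suc p) = suc (squash s p)

  squash-0 : ∀ s → squash s 0 ≡ 0
  squash-0 zero    = refl
  squash-0 (suc _) = refl

  squash-above : ∀ {s p} → s ≤ p → squash s (2 + p) ≡ p
  squash-above {zero}          _         = refl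
  squash-above {suc s} {suc p} (s≤s s≤p) = cong suc (squash-above s≤p)

  squash-centre : ∀ s → squash s (suc s) ≡ s
  squash-centre zero    = refl
  squash-centre (suc s) = cong suc (squash-centre s)

  squash-near : ∀ s p → ∣ suc s - p ∣ ≡ 1 → squash s p ≡ s
  squash-near zero    0                   _ = refl
  squash-near zero    2                   _ = refl
  squash-near (suc s) (suc p)             e = cong suc (squash-near s p e)

  -- With `squash-centre` and `squash-near` this identifies the fibre over `s` as the levels `s`,
  -- `s + 1` and `s + 2`, those of a path node at level `s + 1` and its neighbours.
  squash-merged : ∀ s p → squash s p ≡ s → suc s ≡ p ⊎ ∣ suc s - p ∣ ≡ 1
  squash-merged zero    0       _ = inj₂ refl
  squash-merged zero    1       _ = inj₁ refl
  squash-merged zero    2       _ = inj₂ refl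
  squash-merged (suc s) (suc p) e with squash-merged s p (ℕ.suc-injective e)
  ... | inj₁ refl = inj₁ refl
  ... | inj₂ e₁   = inj₂ e₁

  squash-merged-≤ : ∀ s p → squash s p ≡ s → p ≤ 2 + s
  squash-merged-≤ zero    p       e = ℕ.m∸n≡0⇒m≤n e
  squash-merged-≤ (suc s) zero    _ = z≤n
  squash-merged-≤ (suc s) (suc p) e = s≤s (squash-merged-≤ s p (ℕ.suc-injective e))

  squash≡0 : ∀ s p → squash s p ≢ s → squash s p ≡ 0 → p ≡ 0
  squash≡0 zero    _    p≢ e = ⊥-elim (p≢ e)
  squash≡0 (suc s) zero _  _ = refl

  -- Consecutive levels outside the fibre lie on the same side of it, and there `squash s` is the
  -- identity (below) or subtraction of 2 (above).
  squash-gap⁺ : ∀ s p q → squash s p ≢ s → squash s q ≢ s →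
                ∣ p - q ∣ ≡ 1 → ∣ squash s p - squash s q ∣ ≡ 1
  squash-gap⁺ zero    0 _ p≢ _ _ = ⊥-elim (p≢ refl)
  squash-gap⁺ zero    1 _ p≢ _ _ = ⊥-elim (p≢ refl)
  squash-gap⁺ zero    (suc (suc p)) 0 _ q≢ _ = ⊥-elim (q≢ refl)
  squash-gap⁺ zero    (suc (suc p)) 1 _ q≢ _ = ⊥-elim (q≢ refl)
  squash-gap⁺ zero    (suc (suc p)) (suc (suc q)) _ _ e = e
  squash-gap⁺ (suc s) zero    (suc zero)    _ _ _ = cong suc (squash-0 s)
  squash-gap⁺ (suc s) (suc zero) zero       _ _ _ = cong suc (squash-0 s)
  squash-gap⁺ (suc s) (suc p) (suc q) p≢ q≢ e = squash-gap⁺ s p q (p≢ ∘ cong suc) (q≢ ∘ cong suc) e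

  -- Levels on opposite sides of the fibre keep images on opposite sides of `s`, at least 2 apart;
  -- so `p` and `q` are on the same side, where gaps are preserved.
  squash-gap⁻ : ∀ s p q → squash s p ≢ s → squash s q ≢ s →
                ∣ squash s p - squash s q ∣ ≡ 1 → ∣ p - q ∣ ≡ 1
  squash-gap⁻ zero    0 _ p≢ _ _ = ⊥-elim (p≢ refl)
  squash-gap⁻ zero    1 _ p≢ _ _ = ⊥-elim (p≢ refl)
  squash-gap⁻ zero    (suc (suc p)) 0 _ q≢ _ = ⊥-elim (q≢ refl)
  squash-gap⁻ zero    (suc (suc p)) 1 _ q≢ _ = ⊥-elim (q≢ refl)
  squash-gap⁻ zero    (suc (suc p)) (suc (suc q)) _ _ e = e
  squash-gap⁻ (suc s) zero    (suc q) _ q≢ e =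
    cong suc (squash≡0 s q (q≢ ∘ cong suc) (ℕ.suc-injective e))
  squash-gap⁻ (suc s) (suc p) zero    p≢ _ e =
    cong suc (squash≡0 s p (p≢ ∘ cong suc) (ℕ.suc-injective e))
  squash-gap⁻ (suc s) (suc p) (suc q) p≢ q≢ e = squash-gap⁻ s p q (p≢ ∘ cong suc) (q≢ ∘ cong suc) e

  squash-leave : ∀ s p q → squash s p ≢ s → squash s q ≡ s → ∣ q - p ∣ ≡ 1 → ∣ squash s p - s ∣ ≡ 1
  squash-leave zero    0                   _             p≢ _ _ = ⊥-elim (p≢ refl)
  squash-leave zero    1                   _             p≢ _ _ = ⊥-elim (p≢ refl)
  squash-leave zero    2                   _             p≢ _ _ = ⊥-elim (p≢ refl)
  squash-leave zero    3                   _             _  _ _ = refl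
  squash-leave zero    (suc (suc (suc (suc p)))) 2       _  _ ()
  squash-leave zero    (suc (suc (suc (suc p)))) (suc (suc (suc q))) _ () _
  squash-leave (suc s) zero    (suc zero)    _  e _ = trans (sym e) (cong suc (squash-0 s))
  squash-leave (suc s) (suc p) (suc q)       p≢ e f = squash-leave s p q (p≢ ∘ cong suc) (ℕ.suc-injective e) f

  -- The witness is the fibre level next to `p`: `s + 2` when `p` lies above the fibre, `s` when it
  -- lies below.
  squash-enter : ∀ s p → ∣ squash s p - s ∣ ≡ 1 → ∃[ q ] squash s q ≡ s × ∣ q - p ∣ ≡ 1
  squash-enter zero    (suc (suc (suc zero))) _ = 2 , refl , refl
  squash-enter (suc zero)    zero    _ = 1 , refl , refl
  squash-enter (suc s) (suc p) e with squash-enter s p e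
  ... | q , e₁ , e₂ = suc q , cong suc e₁ , e₂

  -- Inside the path three levels fall on `s`, one of them accounting for the entry `s` of
  -- `range k`. For `s = 0` and `s = suc k` only two path levels do, the third merged level being
  -- that of the leaves. Either way two surplus copies of `s` appear.
  map-squash-range : ∀ {s k} → s ≤ suc k → map (squash s) (range (2 + k)) ↭ s ∷ s ∷ range k
  map-squash-range {zero} {k} _ =
    ↭-reflexive (cong (λ l → 0 ∷ 0 ∷ l)
      (trans (cong (map (_∸ 2)) (sym (map-∘ (range k))))
        (trans (sym (map-∘ (range k))) (map-id (range k)))))
  map-squash-range {suc s} {k} (s≤s s≤k) = begin
    suc (squash s 0) ∷ map (squash (suc s)) (map suc (range (suc k)))
      ≡⟨ cong₂ (λ p l → suc p ∷ l) (squash-0 s)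
             (trans (sym (map-∘ (range (suc k)))) (map-∘ (range (suc k)))) ⟩
    1 ∷ map suc (map (squash s) (range (suc k)))
      ↭⟨ tail k s≤k ⟩
    suc s ∷ suc s ∷ range k ∎
    where
    open PermutationReasoning
    tail : ∀ k → s ≤ k → 1 ∷ map suc (map (squash s) (range (suc k))) ↭ suc s ∷ suc s ∷ range k
    tail zero    z≤n = ↭-refl
    tail (suc k) s≤k = begin
      1 ∷ map suc (map (squash s) (range (2 + k)))
        ↭⟨ prep 1 (map⁺ suc (map-squash-range s≤k)) ⟩
      1 ∷ suc s ∷ suc s ∷ map suc (range k)
        ↭⟨ shift 1 (suc s ∷ suc s ∷ []) _ ⟨
      suc s ∷ suc s ∷ 1 ∷ map suc (range k) ∎

  map-squash-cometLevels : ∀ a b {s k} → s ≤ suc k →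
    map (squash s) (cometLevels a b (2 + k)) ↭ s ∷ s ∷ cometLevels a b k
  map-squash-cometLevels a b {s} {k} s≤ = begin
    map (squash s) (replicate a 0 ++ replicate b (3 + k) ++ range (2 + k))
      ≡⟨ trans (map-++ (squash s) (replicate a 0) _)
           (cong₂ _++_ (trans (map-replicate (squash s) a 0) (cong (replicate a) (squash-0 s)))
             (trans (map-++ (squash s) (replicate b (3 + k)) _)
               (cong (_++ map (squash s) (range (2 + k)))
                 (trans (map-replicate (squash s) b (3 + k)) (cong (replicate b) (squash-above s≤)))))) ⟩
    as ++ bs ++ map (squash s) (range (2 + k))
      ↭⟨ ++⁺ˡ as (++⁺ˡ bs (map-squash-range s≤)) ⟩
    as ++ bs ++ s ∷ s ∷ range k
      ↭⟨ ++⁺ˡ as (shifts bs (s ∷ s ∷ [])) ⟩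
    as ++ s ∷ s ∷ bs ++ range k
      ↭⟨ shifts as (s ∷ s ∷ []) ⟩
    s ∷ s ∷ as ++ bs ++ range k ∎
    where
    open PermutationReasoning
    as = replicate a 0
    bs = replicate b (suc k)

  -- A criterion for a contraction to be a double comet.

  module _ (G : Graph) (z : Graph.Node G) (c : ℕ) (h : Graph.Node G → ℕ) where
    open Graph G

    contractedLevel : ContractedNode G z → ℕ
    contractedLevel v′         = c
    contractedLevel (kept x _) = h x

    contractedLevels :
      (∀ {x} → Replaced G z x → h x ≡ c) → (∀ {x} → h x ≡ c → Replaced G z x) →
      ∀ xs → map contractedLevel (keptNodes G z xs) ≡ map h xs ∖ c
    contractedLevels to from [] = refl
    contractedLevels to from (x ∷ xs) with replaced? G z x
    ... | yes r = trans (contractedLevels to from xs)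
                        (sym (filter-reject (λ p → ¬? (c ℕ.≟ p)) {xs = map h xs} (λ c≢ → c≢ (sym (to r)))))
    ... | no ¬r = trans (cong (h x ∷_) (contractedLevels to from xs))
                        (sym (filter-accept (λ p → ¬? (c ℕ.≟ p)) {xs = map h xs} (λ c≡ → ¬r (from (sym c≡)))))

    -- Shared by leaf and path contractions: `h` relabels the nodes of `G` so that its fibre over
    -- `c` is the closed neighbourhood of `z`, and the new node takes level `c`. The four middle
    -- hypotheses match adjacency with gaps, first among kept nodes, then between a kept node and
    -- the new one; the last counts a single entry for the whole fibre.
    contraction-isComet : ∀ {a b k} →
      (∀ {x} → Replaced G z x → h x ≡ c) → (∀ {x} → h x ≡ c → Replaced G z x) →
      (∀ {x y} → h x ≢ c → h y ≢ c → x ∼ y → ∣ h x - h y ∣ ≡ 1) →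
      (∀ {x y} → h x ≢ c → h y ≢ c → ∣ h x - h y ∣ ≡ 1 → x ∼ y) →
      (∀ {x y} → h x ≢ c → h y ≡ c → y ∼ x → ∣ h x - c ∣ ≡ 1) →
      (∀ {x} → h x ≢ c → ∣ h x - c ∣ ≡ 1 → ∃[ y ] h y ≡ c × y ∼ x) →
      c ∷ (map h nodes ∖ c) ↭ cometLevels a b k →
      IsComet (contraction G z) a b k
    contraction-isComet to from gap⁺ gap⁻ out⁺ out⁻ ls = record
      { level  = contractedLevel
      ; ∼⇒gap  = λ {x} {y} → ∼⇒gap′ x y
      ; gap⇒∼  = λ {x} {y} → gap⇒∼′ x y
      ; levels = ↭-trans (↭-reflexive (cong (c ∷_) (contractedLevels to from nodes))) ls
      }
      where
      h≢ : ∀ {x} → .(¬ Replaced G z x) → h x ≢ c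
      h≢ ¬r e = ⊥-elim-irr (¬r (from e))

      ∼⇒gap′ : ∀ x y → ContractedAdj G z x y → ∣ contractedLevel x - contractedLevel y ∣ ≡ 1
      ∼⇒gap′ v′         (kept _ r) (_ , s , e) = trans (ℕ.∣-∣-comm c _) (out⁺ (h≢ r) (to s) e)
      ∼⇒gap′ (kept _ r) v′         (_ , s , e) = out⁺ (h≢ r) (to s) e
      ∼⇒gap′ (kept _ r) (kept _ s) e           = gap⁺ (h≢ r) (h≢ s) e

      neighbour : ∀ {x} → .(¬ Replaced G z x) → ∣ h x - c ∣ ≡ 1 → ∃[ y ] Replaced G z y × y ∼ x
      neighbour ¬r e = let y , hy , y∼x = out⁻ (h≢ ¬r) e in y , from hy , y∼x

      gap⇒∼′ : ∀ x y → ∣ contractedLevel x - contractedLevel y ∣ ≡ 1 → ContractedAdj G z x y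
      gap⇒∼′ v′         v′         e with trans (sym e) (ℕ.∣n-n∣≡0 c)
      ... | ()
      gap⇒∼′ v′         (kept x r) e = neighbour r (trans (ℕ.∣-∣-comm (h x) c) e)
      gap⇒∼′ (kept _ r) v′         e = neighbour r e
      gap⇒∼′ (kept _ r) (kept _ s) e = gap⁻ (h≢ r) (h≢ s) e

  -- Contracting a leaf.

  module _ {G : Graph} {a b k : ℕ} (C : IsComet G (suc a) (suc b) k) where
    open Graph G
    open IsComet C

    -- A leaf whose neighbours form level c merges into that level, so the other levels stay put.
    leaf-contraction : ∀ {a′ b′} z c → 1 ≤ c → c ≤ k →
      (∀ {x} → z ∼ x → level x ≡ c) → (∀ {x} → level x ≡ c → z ∼ x) →
      map level nodes ↭ level z ∷ cometLevels a′ b′ k →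
      IsComet (contraction G z) a′ b′ k
    leaf-contraction {a′} {b′} z c 1≤c c≤k ∼⇒c c⇒∼ ls =
      contraction-isComet G z c h to from gap⁺ gap⁻ out⁺ out⁻ contracted
      where
      h : Node → ℕ
      h x with z ≟ x
      ... | yes _ = c
      ... | no  _ = level x

      h-z : h z ≡ c
      h-z with z ≟ z
      ... | yes _  = refl
      ... | no z≢z = ⊥-elim (z≢z refl)

      h-other : ∀ {x} → z ≢ x → h x ≡ level x
      h-other {x} z≢x with z ≟ x
      ... | yes z≡x = ⊥-elim (z≢x z≡x)
      ... | no  _   = refl

      h-out : ∀ {x} → h x ≢ c → h x ≡ level x
      h-out hx≢ = h-other λ { refl → hx≢ h-z }

      to : ∀ {x} → Replaced G z x → h x ≡ c
      to (inj₁ refl) = h-z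
      to {x} (inj₂ z∼x) = trans (h-other λ { refl → ∼-irrefl z∼x }) (∼⇒c z∼x)

      from : ∀ {x} → h x ≡ c → Replaced G z x
      from {x} hx with z ≟ x
      ... | yes z≡x = inj₁ (sym z≡x)
      ... | no  _   = inj₂ (c⇒∼ hx)

      gap⁺ : ∀ {x y} → h x ≢ c → h y ≢ c → x ∼ y → ∣ h x - h y ∣ ≡ 1
      gap⁺ x≢ y≢ e = trans (cong₂ ∣_-_∣ (h-out x≢) (h-out y≢)) (∼⇒gap e)

      gap⁻ : ∀ {x y} → h x ≢ c → h y ≢ c → ∣ h x - h y ∣ ≡ 1 → x ∼ y
      gap⁻ x≢ y≢ e = gap⇒∼ (trans (sym (cong₂ ∣_-_∣ (h-out x≢) (h-out y≢))) e)

      out⁺ : ∀ {x y} → h x ≢ c → h y ≡ c → y ∼ x → ∣ h x - c ∣ ≡ 1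
      out⁺ {x} {y} x≢ hy y∼x with from hy
      -- Here `y` is `z` itself, all of whose neighbours have level `c`, so `x` would have it too.
      ... | inj₁ refl = ⊥-elim (x≢ (trans (h-out x≢) (∼⇒c y∼x)))
      ... | inj₂ z∼y  = trans (cong₂ ∣_-_∣ (h-out x≢) (sym (∼⇒c z∼y))) (∼⇒gap (∼-sym y∼x))

      out⁻ : ∀ {x} → h x ≢ c → ∣ h x - c ∣ ≡ 1 → ∃[ y ] h y ≡ c × y ∼ x
      out⁻ x≢ e with inhabited C (ℕ.m≤n⇒m≤1+n c≤k)
      ... | y , ly = y , to (inj₂ (c⇒∼ ly)) ,
                     ∼-sym (gap⇒∼ (trans (cong₂ ∣_-_∣ (sym (h-out x≢)) ly) e))

      others = _without_ _≟_ nodes z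

      contracted : c ∷ (map h nodes ∖ c) ↭ cometLevels a′ b′ k
      contracted = begin
        c ∷ (map h nodes ∖ c)
          ↭⟨ prep c (filter-↭ _ (map⁺ h (without-↭ _≟_ unique (complete z)))) ⟨
        c ∷ ((h z ∷ map h others) ∖ c)
          ≡⟨ cong₂ (λ p l → c ∷ ((p ∷ l) ∖ c)) h-z
               (map-cong-local (All.map h-other (All.all-filter (λ y → ¬? (z ≟ y)) nodes))) ⟩
        c ∷ ((c ∷ map level others) ∖ c)
          ≡⟨ cong (c ∷_) (without-≡ ℕ._≟_ c (map level others)) ⟩
        c ∷ (map level others ∖ c)
          -- Both `without-↭` and `ls` split off `level z`; cancelling it identifies the levels of
          -- the remaining nodes.
          ↭⟨ prep c (filter-↭ _ (drop-∷ (↭-trans (map⁺ level (without-↭ _≟_ unique (complete z))) ls))) ⟩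
        c ∷ (cometLevels a′ b′ k ∖ c)
          ↭⟨ refill-inner a′ b′ 1≤c c≤k ⟩
        cometLevels a′ b′ k ∎
        where open PermutationReasoning

    bottomLeaf-contraction : ∀ z → 1 ≤ k → level z ≡ 0 → IsComet (contraction G z) a (suc b) k
    bottomLeaf-contraction z 1≤k lz = leaf-contraction z 1 ℕ.≤-refl 1≤k
      (λ {x} z∼x → trans (cong ∣_- level x ∣ (sym lz)) (∼⇒gap z∼x))
      (λ {x} lx → gap⇒∼ (cong₂ ∣_-_∣ lz lx))
      (↭-trans levels (↭-reflexive (cong (_∷ cometLevels a (suc b) k) (sym lz))))

    topLeaf-contraction : ∀ z → 1 ≤ k → level z ≡ suc k → IsComet (contraction G z) (suc a) b k
    topLeaf-contraction z 1≤k lz = leaf-contraction z k 1≤k ℕ.≤-refl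
      (λ {x} z∼x → below (level-≤ C x) (trans (cong ∣_- level x ∣ (sym lz)) (∼⇒gap z∼x)))
      (λ {x} lx → gap⇒∼ (trans (cong₂ ∣_-_∣ lz lx) (∣1+n-n∣≡1 k)))
      (↭-trans levels (↭-trans (shift (suc k) (replicate (suc a) 0) _)
        (↭-reflexive (cong (_∷ cometLevels (suc a) b k) (sym lz)))))
      where
      -- The other level at gap 1 from `suc q` is `suc (suc q)`, which the bound excludes.
      below : ∀ {p q} → p ≤ suc q → ∣ suc q - p ∣ ≡ 1 → p ≡ q
      below {p} p≤ e = ℕ.suc-injective
        (trans (cong (_+ p) (sym (trans (sym (ℕ.m≤n⇒∣n-m∣≡n∸m p≤)) e))) (ℕ.m∸n+n≡m p≤))

  -- Contracting a path node.

  module _ {G : Graph} {a b k : ℕ} (C : IsComet G (suc a) (suc b) (2 + k)) where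
    open Graph G
    open IsComet C

    -- Since `z` is alone at level `suc s`, its closed neighbourhood consists of all nodes at levels
    -- `s`, `s + 1` and `s + 2`, which is what `squash s` merges. The hypothesis on `s ∷ ...`
    -- decides whether the new node is a path node or the only leaf of its end.
    path-contraction : ∀ {a′ b′} z s → s ≤ suc k → level z ≡ suc s → (∀ {x} → level x ≡ suc s → x ≡ z) →
      s ∷ (cometLevels (suc a) (suc b) k ∖ s) ↭ cometLevels a′ b′ k →
      IsComet (contraction G z) a′ b′ k
    path-contraction {a′} {b′} z s s≤ lz unique-z refill =
      contraction-isComet G z s (squash s ∘ level) to from
        (λ {x} {y} x≢ y≢ e → squash-gap⁺ s (level x) (level y) x≢ y≢ (∼⇒gap e))
        (λ {x} {y} x≢ y≢ e → gap⇒∼ (squash-gap⁻ s (level x) (level y) x≢ y≢ e))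
        (λ {x} {y} x≢ y≡ e → squash-leave s (level x) (level y) x≢ y≡ (∼⇒gap e))
        (λ _ → out⁻)
        contracted
      where
      to : ∀ {x} → Replaced G z x → squash s (level x) ≡ s
      to (inj₁ refl) = trans (cong (squash s) lz) (squash-centre s)
      to {x} (inj₂ e) = squash-near s (level x) (trans (cong ∣_- level x ∣ (sym lz)) (∼⇒gap e))

      from : ∀ {x} → squash s (level x) ≡ s → Replaced G z x
      from {x} e with squash-merged s (level x) e
      ... | inj₁ lx  = inj₁ (unique-z (sym lx))
      ... | inj₂ gap = inj₂ (gap⇒∼ (trans (cong ∣_- level x ∣ lz) gap))

      out⁻ : ∀ {x} → ∣ squash s (level x) - s ∣ ≡ 1 → ∃[ y ] squash s (level y) ≡ s × y ∼ x
      out⁻ {x} e with squash-enter s (level x) e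
      ... | q , q≡ , gap with inhabited C {q} (≤-trans (squash-merged-≤ s q q≡) (s≤s (s≤s s≤)))
      ...   | y , refl = y , q≡ , gap⇒∼ gap

      contracted : s ∷ (map (squash s ∘ level) nodes ∖ s) ↭ cometLevels a′ b′ k
      contracted = begin
        s ∷ (map (squash s ∘ level) nodes ∖ s)
          ≡⟨ cong (λ l → s ∷ (l ∖ s)) (map-∘ nodes) ⟩
        s ∷ (map (squash s) (map level nodes) ∖ s)
          ↭⟨ prep s (filter-↭ _ (↭-trans (map⁺ (squash s) levels)
               (map-squash-cometLevels (suc a) (suc b) s≤))) ⟩
        s ∷ ((s ∷ s ∷ cometLevels (suc a) (suc b) k) ∖ s)
          ≡⟨ cong (s ∷_) (trans (without-≡ ℕ._≟_ s (s ∷ _)) (without-≡ ℕ._≟_ s _)) ⟩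
        s ∷ (cometLevels (suc a) (suc b) k ∖ s)
          ↭⟨ refill ⟩
        cometLevels a′ b′ k ∎
        where open PermutationReasoning

  -- The graph `DC` as a double comet by levels.

  module _ (n a b : ℕ) where

    DC-level : CometNode n a b → ℕ
    DC-level (v _) = 0
    DC-level (u _) = suc (n ∸ a ∸ b)
    DC-level (w s) = suc (toℕ s)

    DC-level-w : ∀ t {x} → DC-level x ≡ suc (toℕ t) → x ≡ w t
    DC-level-w t {u _} e = ⊥-elim (ℕ.<-irrefl (ℕ.suc-injective (sym e)) (Fin.toℕ<n t))
    DC-level-w t {w s} e = cong w (Fin.toℕ-injective (ℕ.suc-injective e))

    map-const : ∀ {A : Set} (p : ℕ) (xs : List A) → map (const p) xs ≡ replicate (length xs) p
    map-const p []       = refl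
    map-const p (x ∷ xs) = cong (p ∷_) (map-const p xs)

    map-const-allFin : ∀ m (p : ℕ) → map (const p) (allFin m) ≡ replicate m p
    map-const-allFin m p = trans (map-const p (allFin m))
      (cong (λ l → replicate l p) (length-tabulate {n = m} (λ i → i)))

    tabulate-range : ∀ k → tabulate {n = k} (suc ∘ toℕ) ≡ range k
    tabulate-range zero    = refl
    tabulate-range (suc k) = cong (1 ∷_)
      (trans (sym (map-tabulate (suc ∘ toℕ) suc)) (cong (map suc) (tabulate-range k)))

    DC-levels : map DC-level (cometNodes n a b) ≡ cometLevels a b (n ∸ a ∸ b)
    DC-levels = trans (map-++ DC-level (v-nodes n a b) _) (cong₂ _++_
        (trans (sym (map-∘ (allFin a))) (map-const-allFin a 0))
        (trans (map-++ DC-level (u-nodes n a b) _) (cong₂ _++_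
          (trans (sym (map-∘ (allFin b))) (map-const-allFin b _))
          (trans (sym (map-∘ (allFin (n ∸ a ∸ b))))
            (trans (map-tabulate (λ i → i) (suc ∘ toℕ)) (tabulate-range (n ∸ a ∸ b)))))))

    DC-isComet : 1 ≤ n ∸ a ∸ b → IsComet (DC n a b) a b (n ∸ a ∸ b)
    DC-isComet 1≤k = record
      { level  = DC-level
      ; ∼⇒gap  = λ {x} {y} → ∼⇒gap x y
      ; gap⇒∼  = λ {x} {y} → gap⇒∼ x y
      ; levels = ↭-reflexive DC-levels
      }
      where
      k = n ∸ a ∸ b

      consecutive⁺ : ∀ {p q} → q ≡ suc p ⊎ p ≡ suc q → ∣ p - q ∣ ≡ 1
      consecutive⁺ {p} {q} (inj₁ refl) = trans (ℕ.∣-∣-comm p q) (∣1+n-n∣≡1 p)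
      consecutive⁺ {p} {q} (inj₂ refl) = ∣1+n-n∣≡1 q

      consecutive⁻ : ∀ p q → ∣ p - q ∣ ≡ 1 → q ≡ suc p ⊎ p ≡ suc q
      consecutive⁻ zero    q       e = inj₁ e
      consecutive⁻ (suc p) zero    e = inj₂ e
      consecutive⁻ (suc p) (suc q) e with consecutive⁻ p q e
      ... | inj₁ refl = inj₁ refl
      ... | inj₂ refl = inj₂ refl

      top⁻ : ∀ (s : Fin k) → suc k ≡ suc (suc (toℕ s)) ⊎ suc (toℕ s) ≡ suc (suc k) → suc (toℕ s) ≡ k
      top⁻ s (inj₁ e) = sym (ℕ.suc-injective e)
      top⁻ s (inj₂ e) = ⊥-elim (ℕ.<-irrefl (ℕ.suc-injective e) (ℕ.m≤n⇒m≤1+n (Fin.toℕ<n s)))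

      ∼⇒gap : ∀ x y → CometAdj n a b x y → ∣ DC-level x - DC-level y ∣ ≡ 1
      ∼⇒gap (v _) (w s) e = e
      ∼⇒gap (w s) (v _) e = e
      ∼⇒gap (u _) (w s) e = consecutive⁺ (inj₂ (cong suc (sym e)))
      ∼⇒gap (w s) (u _) e = consecutive⁺ (inj₁ (cong suc (sym e)))
      ∼⇒gap (w s) (w t) e = consecutive⁺ e

      gap⇒∼ : ∀ x y → ∣ DC-level x - DC-level y ∣ ≡ 1 → CometAdj n a b x y
      -- A gap of 1 between the leaf levels 0 and `suc k` would force `k` to be 0.
      gap⇒∼ (v _) (u _) e = ℕ.m<n⇒n≢0 1≤k (ℕ.suc-injective e)
      gap⇒∼ (u _) (v _) e = ℕ.m<n⇒n≢0 1≤k (ℕ.suc-injective e)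
      gap⇒∼ (u _) (u _) e with trans (sym (ℕ.∣n-n∣≡0 k)) e
      ... | ()
      gap⇒∼ (v _) (w s) e = e
      gap⇒∼ (w s) (v _) e = e
      gap⇒∼ (u _) (w s) e with consecutive⁻ (suc k) (suc (toℕ s)) e
      ... | inj₁ e′ = top⁻ s (inj₂ e′)
      ... | inj₂ e′ = top⁻ s (inj₁ e′)
      gap⇒∼ (w s) (u _) e = top⁻ s (consecutive⁻ (suc (toℕ s)) (suc k) e)
      gap⇒∼ (w s) (w t) e = consecutive⁻ (suc (toℕ s)) (suc (toℕ t)) e

-- Importance as a quotient of integers.

open import Data.Integer.Base as ℤ using (ℤ; +_; -_; _+_; _-_; _*_)
import Data.Integer.Properties as ℤ
open import Data.Integer.Tactic.RingSolver using (solve-∀)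

-- Reduced fractions do not multiply by a closed formula; the law is checked among unnormalised
-- fractions, where equality is cross-multiplication.
fromℚᵘ-* : ∀ x y → ℚ.fromℚᵘ x ℚ.* ℚ.fromℚᵘ y ≡ ℚ.fromℚᵘ (x ℚᵘ.* y)
fromℚᵘ-* x y = ℚ.toℚᵘ-injective (ℚᵘ.≃-trans (ℚ.toℚᵘ-homo-* (ℚ.fromℚᵘ x) (ℚ.fromℚᵘ y))
  (ℚᵘ.≃-trans (ℚᵘ.*-cong (ℚ.toℚᵘ-fromℚᵘ x) (ℚ.toℚᵘ-fromℚᵘ y)) (ℚᵘ.≃-sym (ℚ.toℚᵘ-fromℚᵘ (x ℚᵘ.* y)))))

fromℚᵘ-+ : ∀ x y → ℚ.fromℚᵘ x ℚ.+ ℚ.fromℚᵘ y ≡ ℚ.fromℚᵘ (x ℚᵘ.+ y)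
fromℚᵘ-+ x y = ℚ.toℚᵘ-injective (ℚᵘ.≃-trans (ℚ.toℚᵘ-homo-+ (ℚ.fromℚᵘ x) (ℚ.fromℚᵘ y))
  (ℚᵘ.≃-trans (ℚᵘ.+-cong (ℚ.toℚᵘ-fromℚᵘ x) (ℚ.toℚᵘ-fromℚᵘ y)) (ℚᵘ.≃-sym (ℚ.toℚᵘ-fromℚᵘ (x ℚᵘ.+ y)))))

infix 8 ⟦_⟧
⟦_⟧ : ℤ → ℚ
⟦ i ⟧ = i ℚ./ 1

⟦⟧-* : ∀ i j → ⟦ i * j ⟧ ≡ ⟦ i ⟧ ℚ.* ⟦ j ⟧
⟦⟧-* i j = sym (fromℚᵘ-* (mkℚᵘ i 0) (mkℚᵘ j 0))

⟦⟧-+ : ∀ i j → ⟦ i + j ⟧ ≡ ⟦ i ⟧ ℚ.+ ⟦ j ⟧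
⟦⟧-+ i j = sym (trans (fromℚᵘ-+ (mkℚᵘ i 0) (mkℚᵘ j 0))
  (cong ⟦_⟧ (cong₂ _+_ (ℤ.*-identityʳ i) (ℤ.*-identityʳ j))))

⟦⟧-nonZero : ∀ {i} → i ≢ + 0 → ℚ.NonZero ⟦ i ⟧
⟦⟧-nonZero {i} i≢0 = ℚ.≢-nonZero λ e → i≢0
  (trans (sym (ℤ.*-identityʳ i)) (ℚᵘ.drop-*≡* (ℚ.fromℚᵘ-injective {mkℚᵘ i 0} {mkℚᵘ (+ 0) 0} e)))

/-*-cancel : ∀ i d .{{_ : NonZero d}} → (i ℚ./ d) ℚ.* ⟦ + d ⟧ ≡ ⟦ i ⟧
/-*-cancel i (suc d) = trans (fromℚᵘ-* (mkℚᵘ i d) (mkℚᵘ (+ suc d) 0))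
  (ℚ.fromℚᵘ-cong {mkℚᵘ i d ℚᵘ.* mkℚᵘ (+ suc d) 0} {mkℚᵘ i 0}
    (*≡* (trans (ℤ.*-identityʳ (i * + suc d)) (cong (λ e → i * + suc e) (sym (ℕ.*-identityʳ d))))))

÷-*-cancel : ∀ x y .{{_ : ℚ.NonZero y}} → (x ℚ.÷ y) ℚ.* y ≡ x
÷-*-cancel x y = trans (ℚ.*-assoc x (ℚ.1/ y) y) (trans (cong (x ℚ.*_) (ℚ.*-inverseˡ y)) (ℚ.*-identityʳ x))

-- Reduces claims about fractions to cross-multiplied equations, in which integers only get
-- multiplied and added.
isFraction : ∀ {x} i j → j ≢ + 0 → x ℚ.* ⟦ j ⟧ ≡ ⟦ i ⟧ → IsFraction x i j
isFraction {x} i j j≢0 e = nz , (begin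
  x                                   ≡⟨ ℚ.*-identityʳ x ⟨
  x ℚ.* 1ℚ                            ≡⟨ cong (x ℚ.*_) (ℚ.*-inverseʳ ⟦ j ⟧ {{nz}}) ⟨
  x ℚ.* (⟦ j ⟧ ℚ.* (ℚ.1/ ⟦ j ⟧) {{nz}}) ≡⟨ ℚ.*-assoc x ⟦ j ⟧ _ ⟨
  x ℚ.* ⟦ j ⟧ ℚ.* (ℚ.1/ ⟦ j ⟧) {{nz}}   ≡⟨ cong (λ y → y ℚ.* (ℚ.1/ ⟦ j ⟧) {{nz}}) e ⟩
  (⟦ i ⟧ ℚ.÷ ⟦ j ⟧) {{nz}}             ∎)
  where
  open ≡-Reasoning
  nz = ⟦⟧-nonZero j≢0

agglomeration-* : ∀ G (c : Connected G) → Graph.order G ≢ 1 →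
                  agglomeration G c ℚ.* ⟦ + distanceSum G c ⟧ ≡ ⟦ + (Graph.order G ∸ 1) ⟧
agglomeration-* G c m≢1 with Graph.order G ℕ.≟ 1
... | yes m≡1 = ⊥-elim (m≢1 m≡1)
... | no  m≢1′ = /-*-cancel (+ (Graph.order G ∸ 1)) (distanceSum G c) {{distanceSum-nonZero G c m≢1′}}

⟦⟧-neg : ∀ i → ⟦ - i ⟧ ≡ ℚ.- ⟦ i ⟧
⟦⟧-neg i = sym (ℚ.toℚᵘ-injective (ℚᵘ.≃-trans (ℚ.toℚᵘ-homo‿- ⟦ i ⟧)
  (ℚᵘ.≃-trans (ℚᵘ.-‿cong (ℚ.toℚᵘ-fromℚᵘ (mkℚᵘ i 0))) (ℚᵘ.≃-sym (ℚ.toℚᵘ-fromℚᵘ (mkℚᵘ (- i) 0))))))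

÷-cross : ∀ x y .{{_ : ℚ.NonZero y}} s s′ m m′ → x ℚ.* ⟦ s ⟧ ≡ ⟦ m ⟧ → y ℚ.* ⟦ s′ ⟧ ≡ ⟦ m′ ⟧ →
          (x ℚ.÷ y) ℚ.* ⟦ m′ * s ⟧ ≡ ⟦ m * s′ ⟧
÷-cross x y s s′ m m′ xs ys′ = begin
  q ℚ.* ⟦ m′ * s ⟧                 ≡⟨ cong (q ℚ.*_) (trans (⟦⟧-* m′ s) (cong (ℚ._* ⟦ s ⟧) (sym ys′))) ⟩
  q ℚ.* (y ℚ.* ⟦ s′ ⟧ ℚ.* ⟦ s ⟧)   ≡⟨ cong (q ℚ.*_) (ℚ.*-assoc y ⟦ s′ ⟧ ⟦ s ⟧) ⟩
  q ℚ.* (y ℚ.* (⟦ s′ ⟧ ℚ.* ⟦ s ⟧)) ≡⟨ ℚ.*-assoc q y (⟦ s′ ⟧ ℚ.* ⟦ s ⟧) ⟨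
  q ℚ.* y ℚ.* (⟦ s′ ⟧ ℚ.* ⟦ s ⟧)   ≡⟨ cong₂ ℚ._*_ (÷-*-cancel x y) (ℚ.*-comm ⟦ s′ ⟧ ⟦ s ⟧) ⟩
  x ℚ.* (⟦ s ⟧ ℚ.* ⟦ s′ ⟧)         ≡⟨ ℚ.*-assoc x ⟦ s ⟧ ⟦ s′ ⟧ ⟨
  x ℚ.* ⟦ s ⟧ ℚ.* ⟦ s′ ⟧           ≡⟨ cong (ℚ._* ⟦ s′ ⟧) xs ⟩
  ⟦ m ⟧ ℚ.* ⟦ s′ ⟧                 ≡⟨ ⟦⟧-* m s′ ⟨
  ⟦ m * s′ ⟧                       ∎
  where
  open ≡-Reasoning
  q = x ℚ.÷ y

-- With x = m/s and y = m′/s′ the value is (m′s - ms′)/(m′s). Expanding by `t` makes room for the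
-- factor 3 in the closed form of the distance sum.
1-÷-isFraction : ∀ x y .{{_ : ℚ.NonZero y}} s s′ m m′ → s ≢ + 0 → m′ ≢ + 0 →
  x ℚ.* ⟦ s ⟧ ≡ ⟦ m ⟧ → y ℚ.* ⟦ s′ ⟧ ≡ ⟦ m′ ⟧ →
  ∀ t → t ≢ + 0 → IsFraction (1ℚ ℚ.- (x ℚ.÷ y)) (m′ * (t * s) - m * (t * s′)) (m′ * (t * s))
1-÷-isFraction x y s s′ m m′ s≢0 m′≢0 xs ys′ t t≢0 = isFraction (m′ * (t * s) - m * (t * s′)) (m′ * (t * s))
  (λ e → [ m′≢0 , (λ ts≡0 → [ t≢0 , s≢0 ]′ (ℤ.i*j≡0⇒i≡0∨j≡0 t ts≡0)) ]′ (ℤ.i*j≡0⇒i≡0∨j≡0 m′ e))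
  (begin
    (1ℚ ℚ.- q) ℚ.* j                  ≡⟨ ℚ.*-distribʳ-+ j 1ℚ (ℚ.- q) ⟩
    1ℚ ℚ.* j ℚ.+ (ℚ.- q) ℚ.* j        ≡⟨ cong₂ ℚ._+_ (ℚ.*-identityˡ j) (sym (ℚ.neg-distribˡ-* q j)) ⟩
    j ℚ.- q ℚ.* j                     ≡⟨ cong (λ z → j ℚ.- z) q*j ⟩
    j ℚ.- ⟦ m * (t * s′) ⟧            ≡⟨ cong (j ℚ.+_) (⟦⟧-neg (m * (t * s′))) ⟨
    j ℚ.+ ⟦ - (m * (t * s′)) ⟧        ≡⟨ ⟦⟧-+ (m′ * (t * s)) (- (m * (t * s′))) ⟨
    ⟦ m′ * (t * s) - m * (t * s′) ⟧   ∎)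
  where
  open ≡-Reasoning
  q = x ℚ.÷ y
  j = ⟦ m′ * (t * s) ⟧

  scale : ∀ z i c → z ℚ.* ⟦ i ⟧ ≡ ⟦ c ⟧ → z ℚ.* ⟦ t * i ⟧ ≡ ⟦ t * c ⟧
  scale z i c e = begin
    z ℚ.* ⟦ t * i ⟧         ≡⟨ cong (z ℚ.*_) (trans (cong ⟦_⟧ (ℤ.*-comm t i)) (⟦⟧-* i t)) ⟩
    z ℚ.* (⟦ i ⟧ ℚ.* ⟦ t ⟧) ≡⟨ ℚ.*-assoc z ⟦ i ⟧ ⟦ t ⟧ ⟨
    z ℚ.* ⟦ i ⟧ ℚ.* ⟦ t ⟧   ≡⟨ cong (ℚ._* ⟦ t ⟧) e ⟩
    ⟦ c ⟧ ℚ.* ⟦ t ⟧         ≡⟨ ⟦⟧-* c t ⟨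
    ⟦ c * t ⟧               ≡⟨ cong ⟦_⟧ (ℤ.*-comm c t) ⟩
    ⟦ t * c ⟧               ∎

  swap₃ : ∀ t i c → i * (t * c) ≡ t * (i * c)
  swap₃ = solve-∀

  q*j : q ℚ.* j ≡ ⟦ m * (t * s′) ⟧
  q*j = trans (cong (λ i → q ℚ.* ⟦ i ⟧) (swap₃ t m′ s))
    (trans (scale q (m′ * s) (m * s′) (÷-cross x y s s′ m m′ xs ys′)) (cong ⟦_⟧ (sym (swap₃ t m s′))))

IMC-isFraction : ∀ G (c : Connected G) z → let G′ = contraction G z in
  Graph.order G ≢ 1 → Graph.order G′ ≢ 1 →
  let S = + distanceSum G c ; S′ = + distanceSum G′ (contraction-connected G z c)
      M = + (Graph.order G ∸ 1) ; M′ = + (Graph.order G′ ∸ 1) in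
  IsFraction (IMC G c z) (M′ * (+ 3 * S) - M * (+ 3 * S′)) (M′ * (+ 3 * S))
IMC-isFraction G c z m≢1 m′≢1 =
  1-÷-isFraction (agglomeration G c) (agglomeration G′ c′) {{agglomeration-nonZero G′ c′}}
    (+ distanceSum G c) (+ distanceSum G′ c′) (+ (Graph.order G ∸ 1)) (+ (Graph.order G′ ∸ 1))
    (λ e → ℕ.≢-nonZero⁻¹ _ {{distanceSum-nonZero G c m≢1}} (ℤ.+-injective e))
    (λ e → ℕ.≢-nonZero⁻¹ _ {{order∸1-nonZero G′ c′ m′≢1}} (ℤ.+-injective e))
    (agglomeration-* G c m≢1) (agglomeration-* G′ c′ m′≢1) (+ 3) (λ ())
  where
  G′ = contraction G z
  c′ = contraction-connected G z c

-- The distance sum as a polynomial.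

Δ : ℤ → ℤ → ℤ → ℤ
Δ a b k = (k + + 1) * (+ 3 * (a + b) * k + + 6 * a * b + k * (k - + 1))
          + + 6 * (b * (b - + 1) + a * (a - + 1))

-- The diagonal surplus, twice the order, is subtracted three times from the closed form over ℕ. The
-- casts to ℤ are first pushed inwards so that the rest is a polynomial identity.
Δ-comet : ∀ {s} a b k → 3 ℕ.* (s ℕ.+ 2 ℕ.* (a ℕ.+ (b ℕ.+ k))) ≡
  6 ℕ.* a ℕ.* a ℕ.+ 6 ℕ.* a ℕ.* b ℕ.* suc k ℕ.+ 3 ℕ.* (a ℕ.+ b) ℕ.* (k ℕ.* suc k)
  ℕ.+ 6 ℕ.* b ℕ.* b ℕ.+ (k ℕ.* k ℕ.* k ℕ.+ 5 ℕ.* k) →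
  + 3 * + s ≡ Δ (+ a) (+ b) (+ k)
Δ-comet {s} a b k e = begin
  + 3 * + s
    ≡⟨ isolate (+ s) (+ a) (+ b) (+ k) ⟩
  + 3 * (+ s + + 2 * (+ a + (+ b + + k))) - + 6 * (+ a + (+ b + + k))
    ≡⟨ cong (_- + 6 * (+ a + (+ b + + k))) (trans (sym lhs) (trans (cong +_ e) rhs)) ⟩
  + 6 * + a * + a + + 6 * + a * + b * (+ 1 + + k) + + 3 * (+ a + + b) * (+ k * (+ 1 + + k)) + + 6 * + b * + b
    + (+ k * + k * + k + + 5 * + k) - + 6 * (+ a + (+ b + + k))
    ≡⟨ polynomial (+ a) (+ b) (+ k) ⟩
  Δ (+ a) (+ b) (+ k) ∎
  where
  open ≡-Reasoning
  lhs : + (3 ℕ.* (s ℕ.+ 2 ℕ.* (a ℕ.+ (b ℕ.+ k)))) ≡ + 3 * (+ s + + 2 * (+ a + (+ b + + k)))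
  lhs = trans (ℤ.pos-* 3 (s ℕ.+ 2 ℕ.* (a ℕ.+ (b ℕ.+ k)))) (cong (λ t → + 3 * (+ s + t))
    (ℤ.pos-* 2 (a ℕ.+ (b ℕ.+ k))))
  pos-*₃ : ∀ x y t → + (x ℕ.* y ℕ.* t) ≡ + x * + y * + t
  pos-*₃ x y t = trans (ℤ.pos-* (x ℕ.* y) t) (cong (_* + t) (ℤ.pos-* x y))
  rhs : + (6 ℕ.* a ℕ.* a ℕ.+ 6 ℕ.* a ℕ.* b ℕ.* suc k ℕ.+ 3 ℕ.* (a ℕ.+ b) ℕ.* (k ℕ.* suc k)
           ℕ.+ 6 ℕ.* b ℕ.* b ℕ.+ (k ℕ.* k ℕ.* k ℕ.+ 5 ℕ.* k)) ≡
    + 6 * + a * + a + + 6 * + a * + b * (+ 1 + + k) + + 3 * (+ a + + b) * (+ k * (+ 1 + + k))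
    + + 6 * + b * + b + (+ k * + k * + k + + 5 * + k)
  rhs = cong₂ _+_ (cong₂ _+_ (cong₂ _+_ (cong₂ _+_ (pos-*₃ 6 a a)
          (trans (ℤ.pos-* (6 ℕ.* a ℕ.* b) (suc k)) (cong (_* + suc k) (pos-*₃ 6 a b))))
          (trans (ℤ.pos-* (3 ℕ.* (a ℕ.+ b)) (k ℕ.* suc k))
            (cong₂ _*_ (ℤ.pos-* 3 (a ℕ.+ b)) (ℤ.pos-* k (suc k)))))
          (pos-*₃ 6 b b))
          (cong₂ _+_ (pos-*₃ k k k) (ℤ.pos-* 5 k))
  isolate : ∀ s a b k → + 3 * s ≡ + 3 * (s + + 2 * (a + (b + k))) - + 6 * (a + (b + k))
  isolate = solve-∀
  polynomial : ∀ a b k →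
    + 6 * a * a + + 6 * a * b * (+ 1 + k) + + 3 * (a + b) * (k * (+ 1 + k)) + + 6 * b * b
    + (k * k * k + + 5 * k) - + 6 * (a + (b + k)) ≡
    (k + + 1) * (+ 3 * (a + b) * k + + 6 * a * b + k * (k - + 1)) + + 6 * (b * (b - + 1) + a * (a - + 1))
  polynomial = solve-∀

module _ {G : Graph} {a b k : ℕ} (C : IsComet G (suc a) (suc b) k) where

  3*distanceSum : ∀ c → + 3 * + distanceSum G c ≡ Δ (+ suc a) (+ suc b) (+ k)
  3*distanceSum c = Δ-comet {distanceSum G c} (suc a) (suc b) k
    (trans (cong (λ m → 3 ℕ.* (distanceSum G c ℕ.+ 2 ℕ.* m)) (sym (order-comet C)))
      (trans (cong (3 ℕ.*_) (distanceSum-comet C c)) (3*ΣΣsep-cometLevels (suc a) (suc b) k)))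

  order≢1 : Graph.order G ≢ 1
  order≢1 e = ℕ.m+1+n≢0 a (ℕ.suc-injective (trans (sym (order-comet C)) e))

  order∸1 : + (Graph.order G ∸ 1) ≡ + suc a + (+ suc b + + k) - + 1
  order∸1 = cong (λ m → + (m ∸ 1)) (order-comet C)

-- Sizes, path lengths and numerator enter as integers tied by equations, so each case can supply
-- its expressions in the stated form together with polynomial identities. `M` and `M′` are the
-- orders less one.
IMC-comet : ∀ {G z a b k a′ b′ k′} c {κ κ′ D X M M′ : _} →
  IsComet G (suc a) (suc b) k → IsComet (contraction G z) (suc a′) (suc b′) k′ →
  κ ≡ + k → κ′ ≡ + k′ → D ≡ Δ (+ suc a) (+ suc b) κ →
  M ≡ + suc a + (+ suc b + κ) - + 1 → M′ ≡ + suc a′ + (+ suc b′ + κ′) - + 1 →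
  X ≡ M′ * D - M * Δ (+ suc a′) (+ suc b′) κ′ →
  IsFraction (IMC G c z) X (M′ * D)
IMC-comet {G} {z} c C C′ refl refl refl refl refl refl = subst₂ (IsFraction (IMC G c z))
  (cong₂ _-_ (cong₂ _*_ (order∸1 C′) (3*distanceSum C c))
             (cong₂ _*_ (order∸1 C) (3*distanceSum C′ (contraction-connected G z c))))
  (cong₂ _*_ (order∸1 C′) (3*distanceSum C c))
  (IMC-isFraction G c z (order≢1 C) (order≢1 C′))

-- The polynomial identities behind the five formulas.

-- From here on Δ is written out: solve-∀ would take the defined function for an opaque constant.
denominator : ∀ n a b → let k = n - a - b ; r = n - a + + 2 * b - + 1 ; p = n - a + b in
  (k + + 1) * (k * r + + 3 * a * p) + + 6 * (b * (b - + 1) + a * (a - + 1)) ≡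
  (k + + 1) * (+ 3 * (a + b) * k + + 6 * a * b + k * (k - + 1)) + + 6 * (b * (b - + 1) + a * (a - + 1))
denominator = solve-∀

-- Here and in the next four identities the arguments of `Δ` are the counts of the contracted comet:
-- a leaf contraction lowers one leaf count by 1, a path contraction lowers `k` by 2, and at an end
-- of the path the leaf count there becomes 1.
bottomLeaf-numerator : ∀ n a b →
  let k = n - a - b ; r = n - a + + 2 * b - + 1 ; p = n - a + b
      A = (k + + 1) * (k * r + + 3 * a * p) ; D = A + + 6 * (b * (b - + 1) + a * (a - + 1))
      Δ = λ a b k → (k + + 1) * (+ 3 * (a + b) * k + + 6 * a * b + k * (k - + 1))
                    + + 6 * (b * (b - + 1) + a * (a - + 1)) in
  (- k - + 1) * (k * r - + 3 * p * (n - a - + 1)) - + 6 * (b * (b - + 1) - (a - + 1) * (+ 2 * n - a - + 2)) ≡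
  (n - + 2) * D - (n - + 1) * Δ (a - + 1) b k
bottomLeaf-numerator = solve-∀

topLeaf-numerator : ∀ n a b →
  let k = n - a - b ; r = n - a + + 2 * b - + 1 ; p = n - a + b
      A = (k + + 1) * (k * r + + 3 * a * p) ; D = A + + 6 * (b * (b - + 1) + a * (a - + 1))
      Δ = λ a b k → (k + + 1) * (+ 3 * (a + b) * k + + 6 * a * b + k * (k - + 1))
                    + + 6 * (b * (b - + 1) + a * (a - + 1)) in
  (k + + 1) * (k * (+ 2 * n + a - + 2 * b - + 2) + + 3 * a * (a - b + n - + 2))
    + + 6 * ((b - + 1) * (- b + + 2 * n - + 2) - a * (a - + 1)) ≡
  (n - + 2) * D - (n - + 1) * Δ a (b - + 1) k
topLeaf-numerator = solve-∀

firstPath-numerator : ∀ n a b →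
  let k = n - a - b ; r = n - a + + 2 * b - + 1 ; p = n - a + b
      A = (k + + 1) * (k * r + + 3 * a * p) ; D = A + + 6 * (b * (b - + 1) + a * (a - + 1))
      Δ = λ a b k → (k + + 1) * (+ 3 * (a + b) * k + + 6 * a * b + k * (k - + 1))
                    + + 6 * (b * (b - + 1) + a * (a - + 1)) in
  (n - a - + 2) * A + + 6 * ((n - a - + 2) * a * (a - + 1) - (a + + 1) * b * (b - + 1))
    - (n - + 1) * (k - + 1) * k * (r - + 1) ≡
  (n - a - + 2) * D - (n - + 1) * Δ (+ 1) b (k - + 2)
firstPath-numerator = solve-∀

lastPath-numerator : ∀ n a b →
  let k = n - a - b ; r = n - a + + 2 * b - + 1 ; p = n - a + b
      A = (k + + 1) * (k * r + + 3 * a * p) ; D = A + + 6 * (b * (b - + 1) + a * (a - + 1))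
      Δ = λ a b k → (k + + 1) * (+ 3 * (a + b) * k + + 6 * a * b + k * (k - + 1))
                    + + 6 * (b * (b - + 1) + a * (a - + 1)) in
  (n - b - + 2) * (A + + 6 * b * (b - + 1)) - (n - + 1) * (k - + 1) * k * (n + + 2 * a - b - + 2)
    - (b + + 1) * + 6 * a * (a - + 1) ≡
  (n - b - + 2) * D - (n - + 1) * Δ a (+ 1) (k - + 2)
lastPath-numerator = solve-∀

innerPath-numerator : ∀ n a b →
  let k = n - a - b ; r = n - a + + 2 * b - + 1 ; p = n - a + b
      A = (k + + 1) * (k * r + + 3 * a * p) ; D = A + + 6 * (b * (b - + 1) + a * (a - + 1))
      Δ = λ a b k → (k + + 1) * (+ 3 * (a + b) * k + + 6 * a * b + k * (k - + 1))
                    + + 6 * (b * (b - + 1) + a * (a - + 1)) in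
  (n - + 3) * A - (n - + 1) * (k - + 1) * ((k - + 2) * (r - + 2) + + 3 * a * (p - + 2))
    - + 12 * (b * (b - + 1) + a * (a - + 1)) ≡
  (n - + 3) * D - (n - + 1) * Δ a b (k - + 2)
innerPath-numerator = solve-∀

-- The five kinds of nodes of `DC`.

IsComet-cong : ∀ {G a b k k′} → k ≡ k′ → IsComet G a b k → IsComet G a b k′
IsComet-cong {a = a} {b} e C = record
  { level  = level
  ; ∼⇒gap  = ∼⇒gap
  ; gap⇒∼  = gap⇒∼
  -- Only this field is transported, so `level` still computes to `DC-level` when the comet is `DC`.
  ; levels = subst (λ k → map level _ ↭ cometLevels a b k) e levels
  }
  where open IsComet C

theorem2p3p1 :
    ∀ (n′ a′ b′ : ℕ) → 2 ≤ a′ → 2 ≤ b′ → (4≤k : 4 ≤ n′ ∸ a′ ∸ b′) →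
    let
      imc = IMC (DC n′ a′ b′) (DC-connected n′ a′ b′ (≤-trans (s≤s z≤n) 4≤k))
      pos = position n′ a′ b′
      n = + n′
      a = + a′
      b = + b′
      k = n - a - b
      r = n - a + + 2 * b - + 1
      p = n - a + b
      A = (k + + 1) * (k * r + + 3 * a * p)
      D = A + + 6 * (b * (b - + 1) + a * (a - + 1))
    in
      ((i : Fin a′) → IsFraction (imc (v i))
        ((- k - + 1) * (k * r - + 3 * p * (n - a - + 1))
          - + 6 * (b * (b - + 1) - (a - + 1) * (+ 2 * n - a - + 2)))
        ((n - + 2) * D))
      ×
      ((j : Fin b′) → IsFraction (imc (u j))
        ((k + + 1) * (k * (+ 2 * n + a - + 2 * b - + 2) + + 3 * a * (a - b + n - + 2))
          + + 6 * ((b - + 1) * (- b + + 2 * n - + 2) - a * (a - + 1)))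
        ((n - + 2) * D))
      ×
      ((t : Fin (n′ ∸ a′ ∸ b′)) → pos t ≡ 1 → IsFraction (imc (w t))
        ((n - a - + 2) * A
          + + 6 * ((n - a - + 2) * a * (a - + 1) - (a + + 1) * b * (b - + 1))
          - (n - + 1) * (k - + 1) * k * (r - + 1))
        ((n - a - + 2) * D))
      ×
      ((t : Fin (n′ ∸ a′ ∸ b′)) → pos t ≡ n′ ∸ a′ ∸ b′ → IsFraction (imc (w t))
        ((n - b - + 2) * (A + + 6 * b * (b - + 1))
          - (n - + 1) * (k - + 1) * k * (n + + 2 * a - b - + 2)
          - (b + + 1) * + 6 * a * (a - + 1))
        ((n - b - + 2) * D))
      ×
      ((t : Fin (n′ ∸ a′ ∸ b′)) → 2 ≤ pos t → pos t ≤ n′ ∸ a′ ∸ b′ ∸ 1 → IsFraction (imc (w t))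
        ((n - + 3) * A
          - (n - + 1) * (k - + 1) * ((k - + 2) * (r - + 2) + + 3 * a * (p - + 2))
          - + 12 * (b * (b - + 1) + a * (a - + 1)))
        ((n - + 3) * D))
theorem2p3p1 n′ a′@(suc (suc a₀)) b′@(suc (suc b₀)) (s≤s (s≤s _)) (s≤s (s≤s _)) 4≤K =
  -- With two leaves at each end, deleting one leaves the positive count `suc a₀` or `suc b₀` that
  -- `IMC-comet` requires.
  (λ i → IMC-comet c C (bottomLeaf-contraction C (v i) 1≤K refl) k≡K k≡K (denominator n a b)
           (order-eq n a b) (bottomLeaf-size n a b) (bottomLeaf-numerator n a b)) ,
  (λ j → IMC-comet c C (topLeaf-contraction C (u j) 1≤K refl) k≡K k≡K (denominator n a b)
           (order-eq n a b) (topLeaf-size n a b) (topLeaf-numerator n a b)) ,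
  -- Contracting `w_t` creates a node at level `t - 1`: level 0 for the first path node, the top
  -- level `suc k₀` for the last, a path level otherwise. This selects the refilling lemma.
  (λ t t≡1 → IMC-comet c C (pathNode-contraction t z≤n t≡1 (refill-bottom a′ b′ k₀)) k≡K k-2≡k₀
           (denominator n a b) (order-eq n a b) (firstPath-size n a b) (firstPath-numerator n a b)) ,
  (λ t t≡K → IMC-comet c C (pathNode-contraction t ℕ.≤-refl (trans t≡K K≡) (refill-top a′ b′ k₀)) k≡K k-2≡k₀
           (denominator n a b) (order-eq n a b) (lastPath-size n a b) (lastPath-numerator n a b)) ,
  (λ t 2≤t t≤K-1 →
     let t≤k₀ = ℕ.≤-pred (subst (λ m → suc (toℕ t) ≤ m ∸ 1) K≡ t≤K-1) in
     IMC-comet c C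
           (pathNode-contraction t (ℕ.m≤n⇒m≤1+n t≤k₀) refl (refill-inner a′ b′ (ℕ.≤-pred 2≤t) t≤k₀)) k≡K k-2≡k₀
           (denominator n a b) (order-eq n a b) (innerPath-size n a b) (innerPath-numerator n a b))
  where
  K = n′ ∸ a′ ∸ b′
  n = + n′
  a = + a′
  b = + b′

  1≤K : 1 ≤ K
  1≤K = ≤-trans (s≤s z≤n) 4≤K

  c = DC-connected n′ a′ b′ 1≤K
  C = DC-isComet n′ a′ b′ 1≤K

  k₀ = K ∸ 2

  K≡ : K ≡ 2 ℕ.+ k₀
  K≡ = sym (ℕ.m+[n∸m]≡n (≤-trans (s≤s (s≤s z≤n)) 4≤K))

  pathNode-contraction : ∀ {a″ b″} t {s} → s ≤ suc k₀ → suc (toℕ t) ≡ suc s →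
    s ∷ (cometLevels a′ b′ k₀ ∖ s) ↭ cometLevels a″ b″ k₀ → IsComet (contraction (DC n′ a′ b′) (w t)) a″ b″ k₀
  pathNode-contraction t {s} s≤ t≡s =
    path-contraction (IsComet-cong K≡ C) (w t) s s≤ t≡s (λ e → DC-level-w n′ a′ b′ t (trans e (sym t≡s)))

  -- As `K` is positive, neither subtraction in `n′ ∸ a′ ∸ b′` truncates, so it agrees with
  -- subtraction in ℤ.
  k≡K : n - a - b ≡ + K
  k≡K = trans (cong (λ m → + m - a - b) n′≡) (cancel a b (+ K))
    where
    a′≤n′ : a′ ≤ n′
    a′≤n′ = ℕ.<⇒≤ (ℕ.m∸n≢0⇒n<m (λ e → ℕ.m<n⇒n≢0 1≤K (trans (cong (_∸ b′) e) (ℕ.0∸n≡0 b′))))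
    b′≤n′∸a′ : b′ ≤ n′ ∸ a′
    b′≤n′∸a′ = ℕ.<⇒≤ (ℕ.m∸n≢0⇒n<m (ℕ.m<n⇒n≢0 1≤K))
    n′≡ : n′ ≡ a′ ℕ.+ (b′ ℕ.+ K)
    n′≡ = sym (trans (cong (a′ ℕ.+_) (ℕ.m+[n∸m]≡n b′≤n′∸a′)) (ℕ.m+[n∸m]≡n a′≤n′))
    cancel : ∀ a b k → a + (b + k) - a - b ≡ k
    cancel = solve-∀

  k-2≡k₀ : n - a - b - + 2 ≡ + k₀
  k-2≡k₀ = trans (cong (_- + 2) k≡K) (cong (λ m → + m - + 2) K≡)

  order-eq : ∀ n a b → n - + 1 ≡ a + (b + (n - a - b)) - + 1
  order-eq = solve-∀
  bottomLeaf-size : ∀ n a b → n - + 2 ≡ (a - + 1) + (b + (n - a - b)) - + 1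
  bottomLeaf-size = solve-∀
  topLeaf-size : ∀ n a b → n - + 2 ≡ a + ((b - + 1) + (n - a - b)) - + 1
  topLeaf-size = solve-∀
  firstPath-size : ∀ n a b → n - a - + 2 ≡ + 1 + (b + (n - a - b - + 2)) - + 1
  firstPath-size = solve-∀
  lastPath-size : ∀ n a b → n - b - + 2 ≡ a + (+ 1 + (n - a - b - + 2)) - + 1
  lastPath-size = solve-∀
  innerPath-size : ∀ n a b → n - + 3 ≡ a + (b + (n - a - b - + 2)) - + 1
  innerPath-size = solve-∀
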